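{- For each fixed $\alpha$ with $0<\alpha<1$, the decision version of $\alpha$-MaxCover belongs to the class $\beta^2$.
   Context: The decision version of $\alpha$-MaxCover: given $(N,{\mathcal{S}},K,T)$ with $N$ a set of $n$ elements, ${\mathcal{S}}$ a family of $m$ subsets of $N$, integers $K,T$, such that for some integer $p$ every element belongs to at least $p$ sets of ${\mathcal{S}}$ and $p/m\ge\alpha$, decide whether some at most $K$ sets of ${\mathcal{S}}$ cover at least $T$ elements. For a positive integer $k$, $\beta^k$ (Kintala–Fisher) is the class of decision problems solvable in polynomial time by an algorithm that uses at most $O(\log^k n)$ nondeterministic bits, where $n$ is the input size. -}

module Defs where

open import Data.Bool.Base using (Bool; true; false)
open import Data.Fin.Base using (Fin)
open import Data.Fin.Subset using (Subset; ⋃; ∣_∣)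
open import Data.Fin.Subset.Properties using (_∈?_)
open import Data.Integer.Base as ℤ using (ℤ; +_; -[1+_])
open import Data.Digit using (toDigits)
open import Data.List.Base as List using (List; []; _∷_; _++_; [_]; length)
open import Data.Maybe.Base using (Maybe; just; nothing)
open import Data.Nat.Base as ℕ using (ℕ; zero; suc; _+_; _*_; _^_; _≤_; NonZero)
open import Data.Nat.Logarithm using (⌊log₂_⌋)
open import Data.Product.Base using (Σ; Σ-syntax; ∃; ∃-syntax; _×_; _,_; proj₁)
open import Data.Rational.Base as ℚ using (ℚ; 0ℚ; 1ℚ)
open import Data.Sum.Base using (_⊎_; inj₁)
open import Data.Vec.Base as Vec using (Vec; []; _∷_)
open import Function.Bundles using (_⇔_; _↔_)
open import Relation.Binary.PropositionalEquality using (_≡_)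
open import Relation.Nullary using (¬_)
open import Relation.Unary using (Pred)

-- Two-sided Dedekind cuts.
record ℝ : Set₁ where
  field
    -- lower q means q < α, and upper q means α < q
    lower upper     : ℚ → Set
    lower-inhabited : ∃ lower
    upper-inhabited : ∃ upper
    lower-rounded   : ∀ q → lower q ⇔ (∃[ r ] q ℚ.< r × lower r)
    upper-rounded   : ∀ q → upper q ⇔ (∃[ r ] r ℚ.< q × upper r)
    disjoint        : ∀ q → ¬ (lower q × upper q)
    located         : ∀ {q r} → q ℚ.< r → lower q ⊎ upper r

Positive : ℝ → Set
Positive α = ℝ.lower α 0ℚ

LessThanOne : ℝ → Set
LessThanOne α = ℝ.upper α 1ℚ

infix 4 _≥ᴿ_

_≥ᴿ_ : ℚ → ℝ → Set
q ≥ᴿ α = ¬ ℝ.lower α q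

data Symbol : Set where
  bit : Bool → Symbol
  ♯   : Symbol

data Direction : Set where
  left stay right : Direction

-- What a machine does in one step: stop with a verdict, perform an action,
-- or consume one nondeterministic bit to choose between two outcomes.
data Step (A : Set) : Set where
  halt   : (accept? : Bool) → Step A
  next   : A → Step A
  choose : A → A → Step A

mapStep : {A B : Set} → (A → B) → Step A → Step B
mapStep f (halt v)     = halt v
mapStep f (next a)     = next (f a)
mapStep f (choose a b) = choose (f a) (f b)

record Machine : Set₁ where
  field
    State       : Set
    #states     : ℕ
    finite      : State ↔ Fin #states
    start       : State
    #extraTapes : ℕ        -- tapes besides the input tape
    #auxSymbols : ℕ        -- tape symbols besides blank and the input symbols

  -- nothing is the blank
  Cell : Set
  Cell = Maybe (Symbol ⊎ Fin #auxSymbols)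

  Action : Set
  Action = State × Vec (Cell × Direction) (suc #extraTapes)

  field
    δ : State → Vec Cell (suc #extraTapes) → Step Action

-- A tape is infinite in both directions. Only finitely many cells are stored
-- on each side of the head, the nearest first; all the others are blank.
record Tape (C : Set) : Set where
  constructor tape
  field
    before : List C
    cell   : C
    after  : List C

module Run (M : Machine) where
  open Machine M

  record Config : Set where
    constructor config
    field
      state : State
      tapes : Vec (Tape Cell) (suc #extraTapes)

  open Config

  uncons : List Cell → Cell × List Cell
  uncons []       = nothing , []
  uncons (c ∷ cs) = c , cs

  move : Direction → Tape Cell → Tape Cell
  move stay  t = t
  move left  (tape ls c rs) = let l , ls′ = uncons ls in tape ls′ l (c ∷ rs)
  move right (tape ls c rs) = let r , rs′ = uncons rs in tape (c ∷ ls) r rs′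

  writeMove : Cell × Direction → Tape Cell → Tape Cell
  writeMove (c , d) (tape ls _ rs) = move d (tape ls c rs)

  perform : Config → Action → Config
  perform γ (q , ws) = config q (Vec.zipWith writeMove ws (tapes γ))

  step : Config → Step Config
  step γ = mapStep (perform γ) (δ (state γ) (Vec.map Tape.cell (tapes γ)))

  inputTape : List Symbol → Tape Cell
  inputTape w =
    let c , cs = uncons (List.map (λ s → just (inj₁ s)) w) in tape [] c cs

  initial : List Symbol → Config
  initial w =
    config start (inputTape w ∷ Vec.replicate #extraTapes (tape [] nothing []))

  -- HaltsWithin t b γ: every computation path from γ halts after at most t
  -- steps and consumes at most b nondeterministic bits.
  data HaltsWithin : ℕ → ℕ → Config → Set where
    halts   : ∀ {t b γ v} → step γ ≡ halt v → HaltsWithin t b γ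
    steps   : ∀ {t b γ γ′} → step γ ≡ next γ′ →
              HaltsWithin t b γ′ → HaltsWithin (suc t) b γ
    chooses : ∀ {t b γ γ₀ γ₁} → step γ ≡ choose γ₀ γ₁ →
              HaltsWithin t b γ₀ → HaltsWithin t b γ₁ →
              HaltsWithin (suc t) (suc b) γ

  -- Some computation path from the configuration halts and accepts.
  data Accepts : Config → Set where
    accepts : ∀ {γ} → step γ ≡ halt true → Accepts γ
    steps   : ∀ {γ γ′} → step γ ≡ next γ′ → Accepts γ′ → Accepts γ
    choose₀ : ∀ {γ γ₀ γ₁} → step γ ≡ choose γ₀ γ₁ → Accepts γ₀ → Accepts γ
    choose₁ : ∀ {γ γ₀ γ₁} → step γ ≡ choose γ₀ γ₁ → Accepts γ₁ → Accepts γ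

infix 4 _=O_

_=O_ : (ℕ → ℕ) → (ℕ → ℕ) → Set
f =O g = ∃[ c ] ∃[ n₀ ] (∀ n → n₀ ≤ n → f n ≤ c * g n)

-- Instance contains only the admissible instances: a decision algorithm may
-- answer arbitrarily on strings that do not encode one of them.
record DecisionProblem : Set₁ where
  field
    Instance : Set
    encode   : Instance → List Symbol
    Yes      : Instance → Set

-- The Kintala–Fisher class. The resource bounds are imposed on every input string; the input size is
-- its length.
β : (k : ℕ) → .{{NonZero k}} → Pred DecisionProblem _
β k P = Σ[ M ∈ Machine ] let open Run M in
  (∃[ t ] ∃[ b ]
     (∃[ d ] t =O (λ n → n ^ d))
   × b =O (λ n → ⌊log₂ n ⌋ ^ k)
   × (∀ w → HaltsWithin (t (length w)) (b (length w)) (initial w)))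
  × (∀ I → Accepts (initial (encode I)) ⇔ Yes I)
  where open DecisionProblem P

-- The family is indexed, so a subset may occur in it more than once. It is
-- nonempty, as the ratio p / m has to make sense.
record CoverInstance : Set where
  field
    n m     : ℕ
    {{m≢0}} : NonZero m
    sets    : Vec (Subset n) m
    K T     : ℤ

  frequency : Fin n → ℕ
  frequency e = Vec.count (e ∈?_) sets

  chosen : Subset m → List (Subset n)
  chosen J = List.map (Vec.lookup sets) (List.filter (_∈? J) (List.allFin m))

  Coverable : Set
  Coverable = Σ[ J ∈ Subset m ] + ∣ J ∣ ℤ.≤ K × T ℤ.≤ + ∣ ⋃ (chosen J) ∣

Dense : ℝ → CoverInstance → Set
Dense α I = Σ[ p ∈ ℤ ] (∀ e → p ℤ.≤ + frequency e) × p ℚ./ m ≥ᴿ α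
  where open CoverInstance I

negative : ℤ → Bool
negative (+ _)    = false
negative -[1+ _ ] = true

digit : Fin 2 → Symbol
digit Fin.zero    = bit false
digit (Fin.suc _) = bit true

-- A sign bit, followed by the binary digits of the absolute value, the least
-- significant first.
encodeℤ : ℤ → List Symbol
encodeℤ z = bit (negative z) ∷ List.map digit (proj₁ (toDigits 2 ℤ.∣ z ∣))

-- K ♯ T ♯ s₁ ♯ … sₘ ♯, where each sᵢ is a characteristic vector of length n
encodeCover : CoverInstance → List Symbol
encodeCover I =
  encodeℤ K ++ ♯ ∷ encodeℤ T ++ ♯ ∷
  List.concatMap (λ s → List.map bit (Vec.toList s) ++ [ ♯ ]) (Vec.toList sets)
  where open CoverInstance I

MaxCover : ℝ → DecisionProblem
MaxCover α = record
  { Instance = Σ CoverInstance (Dense α)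
  ; encode   = λ (I , _) → encodeCover I
  ; Yes      = λ (I , _) → CoverInstance.Coverable I
  }

{-# OPTIONS --safe #-}

-- If every element lies in at least a fraction 1/c of the sets, then some set
-- covers at least a fraction 1/c of what is still uncovered, so greedily chosen
-- sets leave at most a fraction (1 - 1/c)^(c r) ≤ 2^(-r) uncovered: as soon as
-- 2^r exceeds the number of elements, c r sets cover everything. Hence it is
-- enough to guess min (K , c r) sets, where r is the binary length of the
-- family. A set is guessed with r bits, each of which decides which half of
-- the remaining candidates, the odd or the even ones, is struck out.

module Submission where

open import Defs
open import Data.Bool.Base using (Bool; true; false; not; _∨_; if_then_else_)
open import Data.Digit using (toDigits; fromDigits)
open import Data.Fin.Base using (Fin; zero; suc; fromℕ; inject₁; toℕ)
open import Data.Fin.Patterns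
open import Data.Fin.Properties using (toℕ-fromℕ; toℕ-inject₁)
open import Data.Fin.Subset using (Subset; ∁; _∪_; _∩_; ⋃; ⁅_⁆; ∣_∣; _⊆_)
  renaming (⊥ to ∅; _∈_ to _∈ˢ_)
open import Data.Fin.Subset.Properties
  using (_∈?_; ∉⊥; x∈⁅x⁆; x∈p∪q⁺; x∈p∪q⁻; ∣⊥∣≡0; ∣⁅x⁆∣≡1; ∣p∣≤n; ∣∁p∣≡n∸∣p∣; p⊆q⇒∣p∣≤∣q∣)
open import Data.Integer.Base as ℤ using (ℤ; +_; -[1+_]; +≤+; -≤+)
import Data.Integer.Properties as ℤ
open import Data.List.Base as List
  using (List; []; _∷_; [_]; _++_; _ʳ++_; concatMap; length; map; replicate)
open import Data.List.Membership.Propositional using () renaming (_∈_ to _∈ˡ_)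
open import Data.List.Membership.Propositional.Properties
  using (∈-map⁺; ∈-map⁻; ∈-filter⁺; ∈-filter⁻; ∈-allFin)
open import Data.List.Properties using (length-map; length-replicate; length-++; map-cong; map-∘)
open import Data.List.Relation.Unary.All using (All; []; _∷_)
open import Data.List.Relation.Unary.Any using (here; there)
open import Data.Maybe.Base as Maybe using (Maybe; just; nothing)
open import Data.Nat.Base
  using (ℕ; zero; suc; _+_; _*_; _∸_; _^_; _≤_; _<_; z≤n; s≤s; ⌊_/2⌋; ⌈_/2⌉; NonZero)
open import Data.Nat.Coprimality using (Coprime)
open import Data.Nat.Logarithm using (⌊log₂_⌋; ⌊log₂⌋-mono-≤; ⌊log₂[2^n]⌋≡n)
open import Data.Nat.Properties hiding (_≟_)
open import Data.Nat.Tactic.RingSolver using (solve-∀)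
open import Data.Product.Base using (∃; _×_; _,_; proj₁; proj₂)
open import Data.Rational.Base as ℚ using (0ℚ; mkℚ)
import Data.Rational.Properties as ℚ
import Data.Rational.Unnormalised.Base as ℚᵘ
import Data.Rational.Unnormalised.Properties as ℚᵘ
open import Data.Sum.Base as Sum using (_⊎_; inj₁; inj₂; [_,_]′)
open import Data.Vec.Base as Vec using (Vec; []; _∷_; _[_]≔_; lookup; toList)
open import Data.Vec.Properties using (length-toList)
open import Function.Base using (_∘_; id)
open import Function.Bundles using (_⇔_; mk⇔; module Equivalence)
open import Function.Construct.Identity using (↔-id)
open import Relation.Binary.PropositionalEquality hiding ([_])
open import Relation.Nullary using (does; contradiction)
open import Relation.Unary using (_∈_)

-- Binary counters

-- The class imposes its bounds on every input string, including families that are not dense and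
-- strings that encode no family, so halting cannot rest on the greedy argument. The loop is
-- therefore capped from outside: on any input at most `c * r * r` bits are consumed, and density
-- serves only to show that the cap loses no solution. The number `r` is the binary length of the
-- count of all symbols of the family, not of `n` or `m`. One pass computes it without parsing, and
-- `2 ^ r` exceeds both the number of elements and the number of candidates. The real `α` is a
-- Dedekind cut, which a machine cannot hold. It acts only through a positive rational below it,
-- whose denominator yields `c`. The final ♯ of the encoding opens an empty block, so the empty set
-- is always a candidate. It absorbs surplus guesses and the branches in which every candidate is
-- struck out, so the machine need not decide when to stop.

private
  -- The ring solver proves equations, so polynomial inequalities are reduced to equations with an
  -- explicit slack `k`.
  by : ∀ {m n} k → m + k ≡ n → m ≤ n
  by k eq = ≤-trans (m≤m+n _ k) (≤-reflexive eq)

value : List Bool → ℕ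
value []           = 0
value (true ∷ xs)  = suc (2 * value xs)
value (false ∷ xs) = 2 * value xs

increment : List Bool → List Bool
increment []           = true ∷ []
increment (false ∷ xs) = true ∷ xs
increment (true ∷ xs)  = false ∷ increment xs

increments : ℕ → List Bool → List Bool
increments zero    xs = xs
increments (suc n) xs = increments n (increment xs)

increment-length : ∀ xs → length (increment xs) ≤ suc (length xs)
increment-length []           = ≤-refl
increment-length (false ∷ xs) = n≤1+n _
increment-length (true ∷ xs)  = s≤s (increment-length xs)

increments-length : ∀ n xs → length (increments n xs) ≤ n + length xs
increments-length zero    xs = ≤-refl
increments-length (suc n) xs =
  ≤-trans (increments-length n (increment xs))
    (≤-trans (+-monoʳ-≤ n (increment-length xs)) (≤-reflexive (+-suc n _)))

value-increment : ∀ xs → value (increment xs) ≡ suc (value xs)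
value-increment []           = refl
value-increment (false ∷ xs) = refl
value-increment (true ∷ xs)  = trans (cong (2 *_) (value-increment xs)) (*-suc 2 (value xs))

value-increments : ∀ n xs → value (increments n xs) ≡ n + value xs
value-increments zero    xs = refl
value-increments (suc n) xs =
  trans (value-increments n (increment xs))
    (trans (cong (λ z → n + z) (value-increment xs)) (+-suc n (value xs)))

value-< : ∀ xs → value xs < 2 ^ length xs
value-< []           = ≤-refl
value-< (true ∷ xs)  = ≤-trans (≤-reflexive (sym (*-suc 2 (value xs)))) (*-monoʳ-≤ 2 (value-< xs))
value-< (false ∷ xs) = *-monoʳ-< 2 (value-< xs)

data EndsInOne : List Bool → Set where
  one : EndsInOne (true ∷ [])
  _∷_ : ∀ x {xs} → EndsInOne xs → EndsInOne (x ∷ xs)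

increment-one : ∀ {xs} → EndsInOne xs → EndsInOne (increment xs)
increment-one one         = false ∷ one
increment-one (false ∷ e) = true ∷ e
increment-one (true ∷ e)  = false ∷ increment-one e

increments-one : ∀ n {xs} → EndsInOne xs → EndsInOne (increments n xs)
increments-one zero    e = e
increments-one (suc n) e = increments-one n (increment-one e)

one-value : ∀ {xs} → EndsInOne xs → 2 ^ length xs ≤ 2 * value xs
one-value one         = ≤-refl
one-value (false ∷ e) = *-monoʳ-≤ 2 (one-value e)
one-value (true ∷ e)  = *-monoʳ-≤ 2 (m≤n⇒m≤1+n (one-value e))

increments-log : ∀ n → length (increments (suc n) []) ≤ suc ⌊log₂ suc n ⌋
increments-log n = log-bound (increments n (true ∷ [])) (increments-one n one)
  (trans (value-increments n (true ∷ [])) (+-comm n 1))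
  where
  log-bound : ∀ {m} xs → EndsInOne xs → value xs ≡ m → length xs ≤ suc ⌊log₂ m ⌋
  log-bound (x ∷ xs) e refl = s≤s (≤-trans (≤-reflexive (sym (⌊log₂[2^n]⌋≡n (length xs))))
    (⌊log₂⌋-mono-≤ {2 ^ length xs} (*-cancelˡ-≤ {2 ^ length xs} {value (x ∷ xs)} 2 (one-value e))))

decrement : List Bool → Maybe (List Bool)
decrement []           = nothing
decrement (true ∷ xs)  = just (false ∷ xs)
decrement (false ∷ xs) = Maybe.map (true ∷_) (decrement xs)

decrement-length : ∀ xs {ys} → decrement xs ≡ just ys → length ys ≡ length xs
decrement-length (true ∷ xs)  refl = refl
decrement-length (false ∷ xs) eq with decrement xs in eq′
decrement-length (false ∷ xs) refl | just _ = cong suc (decrement-length xs eq′)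

isZero : List Bool → Bool
isZero []           = true
isZero (true ∷ xs)  = false
isZero (false ∷ xs) = isZero xs

enough : List Bool → List Bool → Bool
enough []              T = isZero T
enough (false ∷ flags) T = enough flags T
enough (true ∷ flags)  T = Maybe.maybe′ (enough flags) true (decrement T)

-- Guesses

data Item : Set where
  elem : Bool → Item
  mark : (alive : Bool) → Item

-- k tells whether the next live mark survives.
halve : Bool → List Item → List Item
halve k []                = []
halve k (elem x ∷ xs)     = elem x ∷ halve k xs
halve k (mark true ∷ xs)  = mark k ∷ halve (not k) xs
halve k (mark false ∷ xs) = mark false ∷ halve k xs

-- The pass that reads off the surviving block also undoes the strikes, so every guess starts from
-- the same family.
revive : List Item → List Item
revive []            = []
revive (elem x ∷ xs) = elem x ∷ revive xs
revive (mark _ ∷ xs) = mark true ∷ revive xs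

leading : List Item → List Bool
leading (elem x ∷ xs) = x ∷ leading xs
leading _             = []

picked : List Item → List Bool
picked []                = []
picked (elem _ ∷ xs)     = picked xs
picked (mark true ∷ xs)  = leading xs
picked (mark false ∷ xs) = picked xs

-- The flags keep their length whatever the block is. On malformed input a block can be longer than
-- the flags; its excess is dropped.
merge : List Bool → List Bool → List Bool
merge []       _        = []
merge (y ∷ ys) []       = y ∷ ys
merge (y ∷ ys) (x ∷ xs) = (y ∨ x) ∷ merge ys xs

-- In continuation form: the condition `Q` on the rest of the run sits at the leaves, so the
-- disjunctions mirror the computation tree bit by bit.
Guess : ℕ → List Item → (List Bool → Set) → Set
Guess zero    xs Q = Q (picked xs)
Guess (suc r) xs Q = Guess r (halve true xs) Q ⊎ Guess r (halve false xs) Q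

-- The search ends as soon as the fuel `f` or the counter `K` is used up; this realises the minimum
-- of the two without comparing them.
Cover : ℕ → List Item → List Bool → ℕ → List Bool → List Bool → Set
Cover r xs T zero    K cs = enough cs T ≡ true
Cover r xs T (suc f) K cs =
  Maybe.maybe′ (λ K′ → Guess r xs (Cover r xs T f K′ ∘ merge cs)) (enough cs T ≡ true) (decrement K)

halve-length : ∀ k xs → length (halve k xs) ≡ length xs
halve-length k []                = refl
halve-length k (elem _ ∷ xs)     = cong suc (halve-length k xs)
halve-length k (mark true ∷ xs)  = cong suc (halve-length (not k) xs)
halve-length k (mark false ∷ xs) = cong suc (halve-length k xs)

revive-halve : ∀ k xs → revive (halve k xs) ≡ revive xs
revive-halve k []                = refl
revive-halve k (elem x ∷ xs)     = cong (elem x ∷_) (revive-halve k xs)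
revive-halve k (mark true ∷ xs)  = cong (mark true ∷_) (revive-halve (not k) xs)
revive-halve k (mark false ∷ xs) = cong (mark true ∷_) (revive-halve k xs)

merge-[] : ∀ cs → merge cs [] ≡ cs
merge-[] []       = refl
merge-[] (c ∷ cs) = refl

merge-length : ∀ ys xs → length (merge ys xs) ≡ length ys
merge-length []       xs       = refl
merge-length (y ∷ ys) []       = refl
merge-length (y ∷ ys) (x ∷ xs) = cong suc (merge-length ys xs)

fromSymbol : Symbol → Item
fromSymbol (bit x) = elem x
fromSymbol ♯       = mark true

revive-fromSymbol : ∀ w → revive (map fromSymbol w) ≡ map fromSymbol w
revive-fromSymbol []          = refl
revive-fromSymbol (bit x ∷ w) = cong (elem x ∷_) (revive-fromSymbol w)
revive-fromSymbol (♯ ∷ w)     = cong (mark true ∷_) (revive-fromSymbol w)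

-- The family is preceded by the ♯ that ends T, so each ♯ precedes a block.
blocks : List Symbol → List Item
blocks w = map fromSymbol (♯ ∷ w)

-- The machine ignores the digits of this numeral and uses its length, once to count the bits of a
-- guess and once to ration the rounds.
counter : List Symbol → List Bool
counter w = increments (length (blocks w)) []

-- The machine

-- Time bounds, in a bound on the lengths of all lists involved.
roundTime finalTime : ℕ → ℕ
roundTime N = N + suc N + (N * (3 + (N + N)) + (5 + (N + N + (N + N))))
finalTime N = N * (4 + (N + N)) + (2 + N)

loopTime totalTime : ℕ → ℕ → ℕ
loopTime  d N = N * suc d * suc (roundTime N) + (suc N + finalTime N)
totalTime d N = suc (N + suc (suc N + suc (N + suc (suc N +
  (N * (3 + (N + N)) + suc (suc N + (suc N + loopTime d N)))))))

pattern signK   = zero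
pattern digitsK = suc signK
pattern rewindK = suc digitsK
pattern signT   = suc rewindK
pattern digitsT = suc signT
pattern rewindT = suc digitsT
pattern measure = suc rewindT
pattern carry   = suc measure
pattern uncarry = suc carry
pattern rewindC = suc uncarry
pattern rewindS = suc rewindC
pattern round   = suc rewindS
pattern borrowK = suc round
pattern returnK = suc borrowK
pattern guess   = suc returnK
pattern keep    = suc guess
pattern drop    = suc keep
pattern swept   = suc drop
pattern guessed = suc swept
pattern seek    = suc guessed
pattern unite   = suc seek
pattern skip    = suc unite
pattern count   = suc skip
pattern borrowT = suc count
pattern returnT = suc borrowT
pattern verdict = suc returnT

pattern ␣      = nothing
pattern bitᶜ x = just (inj₁ (bit x))
pattern ♯ᶜ     = just (inj₁ ♯)
pattern dead   = just (inj₂ zero)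
pattern fuel j = just (inj₂ (suc j))

-- Tape 0 holds the input, tape 1 the digits of K, tape 2 those of T, tapes 3
-- and 4 the binary length of the family, and tape 5 a flag for each element
-- covered so far. A ♯ struck out during a guess is dead; fuel j on tape 4
-- allows j more guesses before its head advances, and each digit there is
-- worth c = suc d guesses.
module Algorithm (d : ℕ) where

  private
    Content : Set
    Content = Maybe (Symbol ⊎ Fin (suc (suc d)))

    stays : Vec Content 6 → Vec (Content × Direction) 6
    stays = Vec.map (_, stay)

    δ : Fin 26 → Vec Content 6 → Step (Fin 26 × Vec (Content × Direction) 6)
    -- All six heads advance, which leaves a blank to the left of every tape's content: the stop
    -- that each later rewinding looks for.
    δ signK     (bitᶜ false ∷ _) = next (digitsK , Vec.replicate 6 (␣ , right))
    δ digitsK v@(bitᶜ x ∷ _)     = next (digitsK , stays v [ 0F ]≔ (␣ , right) [ 1F ]≔ (bitᶜ x , right))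
    δ digitsK v@(♯ᶜ ∷ _)         = next (rewindK , stays v [ 0F ]≔ (␣ , right) [ 1F ]≔ (␣ , left))
    δ rewindK v@(_ ∷ just s ∷ _) = next (rewindK , stays v [ 1F ]≔ (just s , left))
    δ rewindK v@(_ ∷ ␣ ∷ _)      = next (signT , stays v [ 1F ]≔ (␣ , right))
    δ signT   v@(bitᶜ false ∷ _) = next (digitsT , stays v [ 0F ]≔ (␣ , right))
    -- Here `K` is known to be nonnegative, so the empty subfamily already meets a negative `T`.
    δ signT     (bitᶜ true ∷ _)  = halt true
    δ digitsT v@(bitᶜ x ∷ _)     = next (digitsT , stays v [ 0F ]≔ (␣ , right) [ 2F ]≔ (bitᶜ x , right))
    -- Unlike the ♯ after `K`, this one stays on the tape: it becomes the mark of the first block.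
    δ digitsT v@(♯ᶜ ∷ _)         = next (rewindT , stays v [ 2F ]≔ (␣ , left))
    δ rewindT v@(_ ∷ _ ∷ just s ∷ _) = next (rewindT , stays v [ 2F ]≔ (just s , left))
    δ rewindT v@(_ ∷ _ ∷ ␣ ∷ _)      = next (measure , stays v [ 2F ]≔ (␣ , right))

    δ measure v@(just s ∷ _) = next (carry , stays v [ 5F ]≔ (bitᶜ false , right))
    δ measure v@(␣ ∷ _ ∷ _ ∷ _ ∷ _ ∷ c ∷ []) = next (rewindC , stays v [ 0F ]≔ (␣ , left) [ 5F ]≔ (c , left))
    δ carry v@(_ ∷ _ ∷ _ ∷ bitᶜ true ∷ _) =
      next (carry , stays v [ 3F ]≔ (bitᶜ false , right) [ 4F ]≔ (bitᶜ false , right))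
    δ carry v = next (uncarry , stays v [ 3F ]≔ (bitᶜ true , left) [ 4F ]≔ (bitᶜ true , left))
    δ uncarry v@(_ ∷ _ ∷ _ ∷ just s ∷ _) =
      next (uncarry , stays v [ 3F ]≔ (just s , left) [ 4F ]≔ (just s , left))
    δ uncarry v@(just s ∷ _ ∷ _ ∷ ␣ ∷ _) =
      next (measure , stays v [ 0F ]≔ (just s , right) [ 3F ]≔ (␣ , right) [ 4F ]≔ (␣ , right))

    δ rewindC v@(_ ∷ _ ∷ _ ∷ _ ∷ _ ∷ just s ∷ _) = next (rewindC , stays v [ 5F ]≔ (just s , left))
    δ rewindC v@(_ ∷ _ ∷ _ ∷ _ ∷ _ ∷ ␣ ∷ _)      = next (rewindS , stays v [ 5F ]≔ (␣ , right))
    δ rewindS v@(just s ∷ _) = next (rewindS , stays v [ 0F ]≔ (just s , left))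
    δ rewindS v@(␣ ∷ _)      = next (round , stays v [ 0F ]≔ (␣ , right))

    δ round v@(_ ∷ _ ∷ _ ∷ _ ∷ ␣ ∷ _)            = next (count , stays v)
    δ round v@(_ ∷ _ ∷ _ ∷ _ ∷ bitᶜ _ ∷ _)       = next (borrowK , stays v [ 4F ]≔ (fuel (fromℕ d) , stay))
    δ round v@(_ ∷ _ ∷ _ ∷ _ ∷ fuel zero ∷ _)    = next (round , stays v [ 4F ]≔ (␣ , right))
    δ round v@(_ ∷ _ ∷ _ ∷ _ ∷ fuel (suc j) ∷ _) = next (borrowK , stays v [ 4F ]≔ (fuel (inject₁ j) , stay))
    δ borrowK v@(_ ∷ bitᶜ false ∷ _) = next (borrowK , stays v [ 1F ]≔ (bitᶜ true , right))
    δ borrowK v@(_ ∷ bitᶜ true ∷ _)  = next (returnK , stays v [ 1F ]≔ (bitᶜ false , left))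
    δ borrowK v@(_ ∷ ␣ ∷ _)          = next (count , stays v)
    δ returnK v@(_ ∷ just s ∷ _)     = next (returnK , stays v [ 1F ]≔ (just s , left))
    δ returnK v@(_ ∷ ␣ ∷ _)          = next (guess , stays v [ 1F ]≔ (␣ , right))

    δ guess v@(_ ∷ _ ∷ _ ∷ bitᶜ x ∷ _) =
      let w = stays v [ 3F ]≔ (bitᶜ x , right) in choose (keep , w) (drop , w)
    δ guess v@(_ ∷ _ ∷ _ ∷ ␣ ∷ _) = next (guessed , stays v [ 3F ]≔ (␣ , left))
    δ keep  v@(♯ᶜ ∷ _)     = next (drop , stays v [ 0F ]≔ (♯ᶜ , right))
    δ keep  v@(just s ∷ _) = next (keep , stays v [ 0F ]≔ (just s , right))
    δ keep  v@(␣ ∷ _)      = next (swept , stays v [ 0F ]≔ (␣ , left))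
    δ drop  v@(♯ᶜ ∷ _)     = next (keep , stays v [ 0F ]≔ (dead , right))
    δ drop  v@(just s ∷ _) = next (drop , stays v [ 0F ]≔ (just s , right))
    δ drop  v@(␣ ∷ _)      = next (swept , stays v [ 0F ]≔ (␣ , left))
    δ swept v@(just s ∷ _) = next (swept , stays v [ 0F ]≔ (just s , left))
    δ swept v@(␣ ∷ _)      = next (guess , stays v [ 0F ]≔ (␣ , right))

    δ guessed v@(_ ∷ _ ∷ _ ∷ just s ∷ _) = next (guessed , stays v [ 3F ]≔ (just s , left))
    δ guessed v@(_ ∷ _ ∷ _ ∷ ␣ ∷ _)      = next (seek , stays v [ 3F ]≔ (␣ , right))
    δ seek  v@(bitᶜ x ∷ _) = next (seek , stays v [ 0F ]≔ (bitᶜ x , right))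
    δ seek  v@(♯ᶜ ∷ _)     = next (unite , stays v [ 0F ]≔ (♯ᶜ , right))
    δ seek  v@(dead ∷ _)   = next (seek , stays v [ 0F ]≔ (♯ᶜ , right))
    δ seek  v@(␣ ∷ _ ∷ _ ∷ _ ∷ _ ∷ c ∷ []) = next (rewindC , stays v [ 0F ]≔ (␣ , left) [ 5F ]≔ (c , left))
    δ unite v@(bitᶜ x ∷ _ ∷ _ ∷ _ ∷ _ ∷ bitᶜ y ∷ []) =
      next (unite , stays v [ 0F ]≔ (bitᶜ x , right) [ 5F ]≔ (bitᶜ (y ∨ x) , right))
    δ unite v@(bitᶜ x ∷ _ ∷ _ ∷ _ ∷ _ ∷ ␣ ∷ []) = next (unite , stays v [ 0F ]≔ (bitᶜ x , right))
    δ unite v@(♯ᶜ ∷ _)   = next (skip , stays v [ 0F ]≔ (♯ᶜ , right))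
    δ unite v@(dead ∷ _) = next (skip , stays v [ 0F ]≔ (♯ᶜ , right))
    δ unite v@(␣ ∷ _ ∷ _ ∷ _ ∷ _ ∷ c ∷ []) = next (rewindC , stays v [ 0F ]≔ (␣ , left) [ 5F ]≔ (c , left))
    δ skip  v@(bitᶜ x ∷ _) = next (skip , stays v [ 0F ]≔ (bitᶜ x , right))
    δ skip  v@(♯ᶜ ∷ _)     = next (skip , stays v [ 0F ]≔ (♯ᶜ , right))
    δ skip  v@(dead ∷ _)   = next (skip , stays v [ 0F ]≔ (♯ᶜ , right))
    δ skip  v@(␣ ∷ _ ∷ _ ∷ _ ∷ _ ∷ c ∷ []) = next (rewindC , stays v [ 0F ]≔ (␣ , left) [ 5F ]≔ (c , left))

    δ count v@(_ ∷ _ ∷ _ ∷ _ ∷ _ ∷ bitᶜ true ∷ _)  = next (borrowT , stays v)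
    δ count v@(_ ∷ _ ∷ _ ∷ _ ∷ _ ∷ bitᶜ false ∷ _) = next (count , stays v [ 5F ]≔ (bitᶜ false , right))
    δ count v@(_ ∷ _ ∷ _ ∷ _ ∷ _ ∷ ␣ ∷ _)          = next (verdict , stays v)
    δ borrowT v@(_ ∷ _ ∷ bitᶜ false ∷ _) = next (borrowT , stays v [ 2F ]≔ (bitᶜ true , right))
    δ borrowT v@(_ ∷ _ ∷ bitᶜ true ∷ _)  = next (returnT , stays v [ 2F ]≔ (bitᶜ false , left))
    δ borrowT   (_ ∷ _ ∷ ␣ ∷ _)          = halt true
    δ returnT v@(_ ∷ _ ∷ just s ∷ _)     = next (returnT , stays v [ 2F ]≔ (just s , left))
    δ returnT v@(_ ∷ _ ∷ ␣ ∷ _ ∷ _ ∷ c ∷ _) =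
      next (count , stays v [ 2F ]≔ (␣ , right) [ 5F ]≔ (c , right))
    δ verdict v@(_ ∷ _ ∷ bitᶜ false ∷ _) = next (verdict , stays v [ 2F ]≔ (bitᶜ false , right))
    δ verdict   (_ ∷ _ ∷ ␣ ∷ _)          = halt true
    -- A negative `K` ends here, and so does a header that breaks off or has a ♯ in place of a sign.
    δ _ _ = halt false

  machine : Machine
  machine = record
    { finite      = ↔-id (Fin 26)
    ; start       = signK
    ; #extraTapes = 5
    ; #auxSymbols = suc (suc d)
    ; δ           = δ
    }

  -- Halting and acceptance of configurations

  open Machine machine using (Cell)
  open Run machine

  -- Bounds and acceptance are proved by one induction, backwards along the run: `A` is the
  -- condition under which the computation still to come from `γ` accepts.
  record Behaves (t b : ℕ) (γ : Config) (A : Set) : Set where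
    constructor behaves
    field
      halting   : HaltsWithin t b γ
      accepting : Accepts γ ⇔ A

  open Behaves public
  open Equivalence

  private variable
    t t′ b b′ N : ℕ
    A A′ : Set
    γ γ′ γ₀ γ₁ : Config

  relax : t ≤ t′ → b ≤ b′ → HaltsWithin t b γ → HaltsWithin t′ b′ γ
  relax _ _ (halts eq) = halts eq
  relax (s≤s p) q (steps eq h) = steps eq (relax p q h)
  relax (s≤s p) (s≤s q) (chooses eq h₀ h₁) = chooses eq (relax p q h₀) (relax p q h₁)

  within : t ≤ t′ → b ≤ b′ → Behaves t b γ A → Behaves t′ b′ γ A
  within p q (behaves h a) = behaves (relax p q h) a

  slower : t ≤ t′ → Behaves t b γ A → Behaves t′ b γ A
  slower p = within p ≤-refl

  halt! : ∀ {v} → step γ ≡ halt v → Behaves t b γ (v ≡ true)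
  halt! {γ} {v = v} eq = behaves (halts eq) (mk⇔ to′ (λ { refl → accepts eq }))
    where
    to′ : Accepts γ → v ≡ true
    to′ (accepts e) with refl ← trans (sym eq) e = refl
    to′ (steps e _) with () ← trans (sym eq) e
    to′ (choose₀ e _) with () ← trans (sym eq) e
    to′ (choose₁ e _) with () ← trans (sym eq) e

  infixr 2 _▸_

  _▸_ : step γ ≡ next γ′ → Behaves t b γ′ A → Behaves (suc t) b γ A
  _▸_ {γ} {γ′} eq (behaves h a) =
    behaves (steps eq h) (mk⇔ (to a ∘ to′) (steps eq ∘ from a))
    where
    to′ : Accepts γ → Accepts γ′
    to′ (accepts e) with () ← trans (sym eq) e
    to′ (steps e x) with refl ← trans (sym eq) e = x
    to′ (choose₀ e _) with () ← trans (sym eq) e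
    to′ (choose₁ e _) with () ← trans (sym eq) e

  branch : step γ ≡ choose γ₀ γ₁ → Behaves t b γ₀ A → Behaves t b γ₁ A′ →
           Behaves (suc t) (suc b) γ (A ⊎ A′)
  branch {γ} {γ₀} {γ₁} eq (behaves h₀ a₀) (behaves h₁ a₁) =
    behaves (chooses eq h₀ h₁)
      (mk⇔ (Sum.map (to a₀) (to a₁) ∘ to′)
           [ choose₀ eq ∘ from a₀ , choose₁ eq ∘ from a₁ ]′)
    where
    to′ : Accepts γ → Accepts γ₀ ⊎ Accepts γ₁
    to′ (accepts e) with () ← trans (sym eq) e
    to′ (steps e _) with () ← trans (sym eq) e
    to′ (choose₀ e x) with refl ← trans (sym eq) e = inj₁ x
    to′ (choose₁ e x) with refl ← trans (sym eq) e = inj₂ x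

  -- Moves along a single tape

  conf : Fin 26 → (t₀ t₁ t₂ t₃ t₄ t₅ : Tape Cell) → Config
  conf q t₀ t₁ t₂ t₃ t₄ t₅ = config q (t₀ ∷ t₁ ∷ t₂ ∷ t₃ ∷ t₄ ∷ t₅ ∷ [])

  -- The head scans the first cell of the right, respectively left, list.
  at atˡ : List Cell → List Cell → Tape Cell
  at  ls rs = tape ls (proj₁ (uncons rs)) (proj₂ (uncons rs))
  atˡ ls rs = tape (proj₂ (uncons ls)) (proj₁ (uncons ls)) rs

  private variable
    X : Set
    ls rs : List Cell

  cells : (X → Symbol ⊎ Fin (suc (suc d))) → List X → List Cell
  cells f = map (just ∘ f)

  bits : List Bool → List Cell
  bits = cells (inj₁ ∘ bit)

  -- The visited part of a tape is kept as the reversed list lz, so that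
  -- lz ʳ++ rs is the tape content read from the left.
  rewind : (L L′ : Tape Cell → Config) →
    (∀ s ls rs → step (L (tape ls (just s) rs)) ≡ next (L (atˡ ls (just s ∷ rs)))) →
    (∀ ls rs → step (L (tape ls ␣ rs)) ≡ next (L′ (at (␣ ∷ ls) rs))) →
    (f : X → Symbol ⊎ Fin (suc (suc d))) (lz : List X) →
    Behaves t b (L′ (at (␣ ∷ ls) (cells f lz ʳ++ rs))) A →
    Behaves (suc (length lz) + t) b (L (atˡ (cells f lz ++ ␣ ∷ ls) rs)) A
  rewind L L′ hop stop f []       B = stop _ _ ▸ B
  rewind L L′ hop stop f (x ∷ lz) B = hop _ _ _ ▸ rewind L L′ hop stop f lz B

  -- The configuration is taken as a function of the one moving tape, with the transitions as
  -- hypotheses, so that the same argument serves `K` on tape 1 and `T` on tape 2.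
  borrow : (L L₁ L₂ : Tape Cell → Config) →
    (∀ ls rs → step (L (tape ls (bitᶜ false) rs)) ≡ next (L (at (bitᶜ true ∷ ls) rs))) →
    (∀ ls rs → step (L (tape ls (bitᶜ true) rs)) ≡ next (L₁ (atˡ ls (bitᶜ false ∷ rs)))) →
    (∀ s ls rs → step (L₁ (tape ls (just s) rs)) ≡ next (L₁ (atˡ ls (just s ∷ rs)))) →
    (∀ ls rs → step (L₁ (tape ls ␣ rs)) ≡ next (L₂ (at (␣ ∷ ls) rs))) →
    ∀ xs lz {ys} → decrement xs ≡ just ys → length lz + length xs ≤ N →
    Behaves t b (L₂ (at (␣ ∷ ls) (bits lz ʳ++ (bits ys ++ rs)))) A →
    Behaves (length xs + suc N + t) b (L (at (bits lz ++ ␣ ∷ ls) (bits xs ++ rs))) A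
  borrow {N = N} {t = t} L L₁ L₂ hop hit hop₁ stop₁ (true ∷ xs) lz refl p B =
    slower (s≤s (+-monoˡ-≤ t (≤-trans (s≤s (m+n≤o⇒m≤o _ p)) (m≤n+m (suc N) (length xs)))))
      (hit _ _ ▸ rewind L₁ L₂ hop₁ stop₁ (inj₁ ∘ bit) lz B)
  borrow {N = N} L L₁ L₂ hop hit hop₁ stop₁ (false ∷ xs) lz eq p B with decrement xs in eq′
  borrow {N = N} L L₁ L₂ hop hit hop₁ stop₁ (false ∷ xs) lz refl p B | just _ =
    hop _ _ ▸ borrow L L₁ L₂ hop hit hop₁ stop₁ xs (true ∷ lz) eq′
                (≤-trans (≤-reflexive (sym (+-suc _ _))) p) B

  -- A failed borrow overwrites the counter with ones. The damage is harmless because the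
  -- continuation is required for every left part `ls`.
  exhaust : (L : Tape Cell → Config) →
    (∀ ls rs → step (L (tape ls (bitᶜ false) rs)) ≡ next (L (at (bitᶜ true ∷ ls) rs))) →
    ∀ xs {ls} → decrement xs ≡ nothing →
    (∀ ls → Behaves t b (L (at ls rs)) A) →
    Behaves (length xs + t) b (L (at ls (bits xs ++ rs))) A
  exhaust L hop []           eq B = B _
  exhaust L hop (false ∷ xs) eq B with decrement xs in eq′
  ... | nothing = hop _ _ ▸ exhaust L hop xs eq′ B

  private variable
    t₀ t₁ t₂ t₃ t₄ t₅ : Tape Cell

  judge : ∀ xs {ls} →
    Behaves (suc (length xs)) b (conf verdict t₀ t₁ (at ls (bits xs ++ ␣ ∷ [])) t₃ t₄ t₅)
      (isZero xs ≡ true)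
  judge []           = halt! refl
  judge (true ∷ xs)  = halt! refl
  judge (false ∷ xs) = refl ▸ judge xs

  on₀ : Fin 26 → {t₁ t₂ t₃ t₄ t₅ : Tape Cell} → Tape Cell → Config
  on₀ q {t₁} {t₂} {t₃} {t₄} {t₅} x = conf q x t₁ t₂ t₃ t₄ t₅

  on₁ : Fin 26 → {t₀ t₂ t₃ t₄ t₅ : Tape Cell} → Tape Cell → Config
  on₁ q {t₀} {t₂} {t₃} {t₄} {t₅} x = conf q t₀ x t₂ t₃ t₄ t₅

  on₂ : Fin 26 → {t₀ t₁ t₃ t₄ t₅ : Tape Cell} → Tape Cell → Config
  on₂ q {t₀} {t₁} {t₃} {t₄} {t₅} x = conf q t₀ t₁ x t₃ t₄ t₅

  on₃ : Fin 26 → {t₀ t₁ t₂ t₄ t₅ : Tape Cell} → Tape Cell → Config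
  on₃ q {t₀} {t₁} {t₂} {t₄} {t₅} x = conf q t₀ t₁ t₂ x t₄ t₅

  on₃₄ : Fin 26 → {t₀ t₁ t₂ t₅ : Tape Cell} → Tape Cell → Config
  on₃₄ q {t₀} {t₁} {t₂} {t₅} x = conf q t₀ t₁ t₂ x x t₅

  on₅ : Fin 26 → {t₀ t₁ t₂ t₃ t₄ : Tape Cell} → Tape Cell → Config
  on₅ q {t₀} {t₁} {t₂} {t₃} {t₄} x = conf q t₀ t₁ t₂ t₃ t₄ x

  tally : ∀ cs T {ls} → length T ≤ N →
    Behaves (length cs * (4 + (N + N)) + (2 + N)) b
      (conf count t₀ t₁ (at (␣ ∷ []) (bits T ++ ␣ ∷ [])) t₃ t₄ (at ls (bits cs ++ ␣ ∷ [])))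
      (enough cs T ≡ true)
  tally []              T p = slower (s≤s (s≤s p)) (refl ▸ judge T)
  tally {N = N} (false ∷ cs) T p =
    slower (+-monoˡ-≤ (2 + N) (s≤s (m≤n+m (length cs * (4 + (N + N))) (3 + (N + N)))))
      (refl ▸ tally cs T p)
  tally {N = N} {b = b} (true ∷ cs) T p with decrement T in eq
  ... | nothing = slower (≤-trans (s≤s (+-monoˡ-≤ 0 p)) (slack N (length cs * (4 + (N + N)))))
    (refl ▸ exhaust (on₂ borrowT) (λ _ _ → refl) T eq λ _ → halt! {b = b} refl)
    where
    slack : ∀ n x → suc (n + 0) ≤ 4 + (n + n) + x + (2 + n)
    slack n x = by (5 + n + n + x) (eq′ n x)
      where
      eq′ : ∀ n x → suc (n + 0) + (5 + n + n + x) ≡ 4 + (n + n) + x + (2 + n)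
      eq′ = solve-∀
  ... | just T′ = slower (≤-trans (s≤s (+-monoˡ-≤ _ (+-monoˡ-≤ _ p)))
                                  (slack N (length cs * (4 + (N + N)))))
    (refl ▸ borrow (on₂ borrowT) (on₂ returnT) (on₂ count) (λ _ _ → refl) (λ _ _ → refl)
      (λ _ _ _ → refl) (λ _ _ → refl) T [] eq p
      (tally cs T′ (≤-trans (≤-reflexive (decrement-length T eq)) p)))
    where
    slack : ∀ n x → suc (n + suc n + (x + (2 + n))) ≤ 4 + (n + n) + x + (2 + n)
    slack n x = by 2 (eq′ n x)
      where
      eq′ : ∀ n x → suc (n + suc n + (x + (2 + n))) + 2 ≡ 4 + (n + n) + x + (2 + n)
      eq′ = solve-∀

  -- A single guess

  along : ∀ (L : List Cell → Config) {xs ys} → xs ≡ ys → Behaves t b (L xs) A → Behaves t b (L ys) A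
  along L refl B = B

  item : Item → Symbol ⊎ Fin (suc (suc d))
  item (elem x)     = inj₁ (bit x)
  item (mark true)  = inj₁ ♯
  item (mark false) = inj₂ zero

  items : List Item → List Cell
  items = cells item

  sweeping : Bool → Fin 26
  sweeping true  = keep
  sweeping false = drop

  +-suc-≤ : ∀ m n {o} → m + suc n ≤ o → suc m + n ≤ o
  +-suc-≤ m n = ≤-trans (≤-reflexive (sym (+-suc m n)))

  -- The alternation in `halve` is kept in the state, `keep` or `drop`, so the machine and the
  -- recursion run in step.
  sweep : ∀ k lz xs → length lz + length xs ≤ N →
    Behaves t b (conf guess (at (␣ ∷ ls) (items lz ʳ++ (items (halve k xs) ++ ␣ ∷ []))) t₁ t₂ t₃ t₄ t₅) A →
    Behaves (suc (length xs) + (suc N + t)) b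
      (conf (sweeping k) (at (items lz ++ ␣ ∷ ls) (items xs ++ ␣ ∷ [])) t₁ t₂ t₃ t₄ t₅) A
  sweep {t = t} true lz [] p B =
    refl ▸ slower (s≤s (+-monoˡ-≤ t (m+n≤o⇒m≤o _ p)))
      (rewind (on₀ swept) (on₀ guess) (λ _ _ _ → refl) (λ _ _ → refl) item lz B)
  sweep {t = t} false lz [] p B =
    refl ▸ slower (s≤s (+-monoˡ-≤ t (m+n≤o⇒m≤o _ p)))
      (rewind (on₀ swept) (on₀ guess) (λ _ _ _ → refl) (λ _ _ → refl) item lz B)
  sweep true lz (elem x ∷ xs) p B = refl ▸ sweep true (elem x ∷ lz) xs (+-suc-≤ (length lz) _ p) B
  sweep true lz (mark true ∷ xs) p B = refl ▸ sweep false (mark true ∷ lz) xs (+-suc-≤ (length lz) _ p) B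
  sweep true lz (mark false ∷ xs) p B = refl ▸ sweep true (mark false ∷ lz) xs (+-suc-≤ (length lz) _ p) B
  sweep false lz (elem x ∷ xs) p B = refl ▸ sweep false (elem x ∷ lz) xs (+-suc-≤ (length lz) _ p) B
  sweep false lz (mark true ∷ xs) p B = refl ▸ sweep true (mark false ∷ lz) xs (+-suc-≤ (length lz) _ p) B
  sweep false lz (mark false ∷ xs) p B = refl ▸ sweep false (mark false ∷ lz) xs (+-suc-≤ (length lz) _ p) B

  -- The common exit of `measure`, `seek`, `unite` and `skip`, which leave the head of tape 5
  -- anywhere among the flags. Splitting on `cs` only exposes the scanned cell.
  restart : ∀ q →
    (∀ {ls ls′ c rs} → step (conf q (tape ls ␣ []) t₁ t₂ t₃ t₄ (tape ls′ c rs)) ≡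
      next (conf rewindC (atˡ ls (␣ ∷ [])) t₁ t₂ t₃ t₄ (atˡ ls′ (c ∷ rs)))) →
    ∀ lz lc cs → length lz ≤ N → length lc ≤ N →
    Behaves t b (conf round (at (␣ ∷ ls) (items lz ʳ++ ␣ ∷ [])) t₁ t₂ t₃ t₄
                            (at (␣ ∷ []) (bits lc ʳ++ (bits cs ++ ␣ ∷ [])))) A →
    Behaves (suc (suc N + (suc N + t))) b
      (conf q (tape (items lz ++ ␣ ∷ ls) ␣ []) t₁ t₂ t₃ t₄
              (at (bits lc ++ ␣ ∷ []) (bits cs ++ ␣ ∷ []))) A
  restart {t = t} q eq lz lc [] p q′ B =
    slower (s≤s (+-mono-≤ (s≤s q′) (s≤s (+-monoˡ-≤ t p))))
      (eq ▸ rewind (on₅ rewindC) (on₅ rewindS) (λ _ _ _ → refl) (λ _ _ → refl) (inj₁ ∘ bit) lc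
        (rewind (on₀ rewindS) (on₀ round) (λ _ _ _ → refl) (λ _ _ → refl) item lz B))
  restart {t = t} q eq lz lc (c ∷ cs) p q′ B =
    slower (s≤s (+-mono-≤ (s≤s q′) (s≤s (+-monoˡ-≤ t p))))
      (eq ▸ rewind (on₅ rewindC) (on₅ rewindS) (λ _ _ _ → refl) (λ _ _ → refl) (inj₁ ∘ bit) lc
        (rewind (on₀ rewindS) (on₀ round) (λ _ _ _ → refl) (λ _ _ → refl) item lz B))

  -- The part `lz` behind the head has its marks revived already; only `xs` still has to pass
  -- through `revive`.
  selected : (ls : List Cell) (t₁ t₂ t₃ t₄ : Tape Cell) →
    List Item → List Item → List Bool → List Bool → Config
  selected ls t₁ t₂ t₃ t₄ lz xs lc cs =
    conf round (at (␣ ∷ ls) (items lz ʳ++ (items (revive xs) ++ ␣ ∷ []))) t₁ t₂ t₃ t₄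
               (at (␣ ∷ []) (bits lc ʳ++ (bits cs ++ ␣ ∷ [])))

  selecting : Fin 26 → (ls : List Cell) (t₁ t₂ t₃ t₄ : Tape Cell) →
    List Item → List Item → List Bool → List Bool → Config
  selecting q ls t₁ t₂ t₃ t₄ lz xs lc cs =
    conf q (at (items lz ++ ␣ ∷ ls) (items xs ++ ␣ ∷ [])) t₁ t₂ t₃ t₄
           (at (bits lc ++ ␣ ∷ []) (bits cs ++ ␣ ∷ []))

  skipping : ∀ lz xs lc cs → length lz + length xs ≤ N → length lc ≤ N →
    Behaves t b (selected ls t₁ t₂ t₃ t₄ lz xs lc cs) A →
    Behaves (length xs + suc (suc N + (suc N + t))) b (selecting skip ls t₁ t₂ t₃ t₄ lz xs lc cs) A
  skipping lz [] lc cs p q B = restart skip refl lz lc cs (m+n≤o⇒m≤o _ p) q B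
  skipping lz (elem x ∷ xs) lc cs p q B =
    refl ▸ skipping (elem x ∷ lz) xs lc cs (+-suc-≤ (length lz) _ p) q B
  skipping lz (mark true ∷ xs) lc cs p q B =
    refl ▸ skipping (mark true ∷ lz) xs lc cs (+-suc-≤ (length lz) _ p) q B
  skipping lz (mark false ∷ xs) lc cs p q B =
    refl ▸ skipping (mark true ∷ lz) xs lc cs (+-suc-≤ (length lz) _ p) q B

  uniting : ∀ lz xs lc cs → length lz + length xs ≤ N → length lc + length cs ≤ N →
    Behaves t b (selected ls t₁ t₂ t₃ t₄ lz xs lc (merge cs (leading xs))) A →
    Behaves (length xs + suc (suc N + (suc N + t))) b (selecting unite ls t₁ t₂ t₃ t₄ lz xs lc cs) A
  uniting lz [] lc cs p q B rewrite merge-[] cs =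
    restart unite refl lz lc cs (m+n≤o⇒m≤o _ p) (m+n≤o⇒m≤o _ q) B
  uniting lz (elem x ∷ xs) lc [] p q B =
    refl ▸ uniting (elem x ∷ lz) xs lc [] (+-suc-≤ (length lz) _ p) q B
  uniting lz (elem x ∷ xs) lc (c ∷ cs) p q B =
    refl ▸ uniting (elem x ∷ lz) xs ((c ∨ x) ∷ lc) cs
             (+-suc-≤ (length lz) _ p) (+-suc-≤ (length lc) _ q) B
  uniting lz (mark true ∷ xs) lc cs p q B rewrite merge-[] cs =
    refl ▸ skipping (mark true ∷ lz) xs lc cs (+-suc-≤ (length lz) _ p) (m+n≤o⇒m≤o _ q) B
  uniting lz (mark false ∷ xs) lc cs p q B rewrite merge-[] cs =
    refl ▸ skipping (mark true ∷ lz) xs lc cs (+-suc-≤ (length lz) _ p) (m+n≤o⇒m≤o _ q) B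

  seeking : ∀ lz xs cs → length lz + length xs ≤ N → length cs ≤ N →
    Behaves t b (selected ls t₁ t₂ t₃ t₄ lz xs [] (merge cs (picked xs))) A →
    Behaves (length xs + suc (suc N + (suc N + t))) b (selecting seek ls t₁ t₂ t₃ t₄ lz xs [] cs) A
  seeking lz [] cs p q B rewrite merge-[] cs =
    restart seek refl lz [] cs (m+n≤o⇒m≤o _ p) z≤n B
  seeking lz (elem x ∷ xs) cs p q B =
    refl ▸ seeking (elem x ∷ lz) xs cs (+-suc-≤ (length lz) _ p) q B
  seeking lz (mark true ∷ xs) cs p q B =
    refl ▸ uniting (mark true ∷ lz) xs [] cs (+-suc-≤ (length lz) _ p) q B
  seeking lz (mark false ∷ xs) cs p q B =
    refl ▸ seeking (mark true ∷ lz) xs cs (+-suc-≤ (length lz) _ p) q B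

  -- The blank behind a tape's content is stored once the head has been there.
  margin : Bool → List Cell
  margin false = []
  margin true  = ␣ ∷ []

  -- Each digit of tape 3 stands for one bit, whatever its value. By `revive-halve` the strikes
  -- leave no trace after the selection, so the continuation can speak of the original `xs`.
  guessing : ∀ zs lz u xs cs {Q : List Bool → Set} →
    length xs ≤ N → length lz + length zs ≤ N → length cs ≤ N →
    (∀ chosen → Behaves t b
      (selected ls t₁ t₂ (at (␣ ∷ []) (bits lz ʳ++ (bits zs ++ margin true))) t₄ [] xs [] (merge cs chosen))
      (Q chosen)) →
    Behaves (length zs * (3 + (N + N)) + (5 + (N + N + (N + N)) + t)) (length zs + b)
      (conf guess (at (␣ ∷ ls) (items xs ++ ␣ ∷ [])) t₁ t₂
        (at (bits lz ++ ␣ ∷ []) (bits zs ++ margin u)) t₄ (at (␣ ∷ []) (bits cs ++ ␣ ∷ [])))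
      (Guess (length zs) xs Q)
  guessing {N = N} {t = t} [] lz u xs cs p q r B =
    slower (≤-trans (s≤s (s≤s (+-mono-≤ (m+n≤o⇒m≤o (length lz) q) (+-monoˡ-≤ _ p)))) (≤-reflexive (eq N t)))
      (turn u ▸ rewind (on₃ guessed) (on₃ seek) (λ _ _ _ → refl) (λ _ _ → refl) (inj₁ ∘ bit) lz
        (seeking [] xs cs p r (B (picked xs))))
    where
    eq : ∀ n t → suc (suc (n + (n + suc (suc n + (suc n + t))))) ≡ 5 + (n + n + (n + n)) + t
    eq = solve-∀
    turn : ∀ u {t₀ t₁ t₂ t₄ t₅ ls} → step (conf guess t₀ t₁ t₂ (at ls (margin u)) t₄ t₅) ≡
      next (conf guessed t₀ t₁ t₂ (atˡ ls (␣ ∷ [])) t₄ t₅)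
    turn false = refl
    turn true  = refl
  guessing {N = N} {t = t} (z ∷ zs) lz u xs cs {Q} p q r B =
    slower (≤-trans (s≤s (s≤s (+-monoˡ-≤ _ p)))
             (≤-reflexive (eq N (length zs * (3 + (N + N))) (5 + (N + N + (N + N)) + t))))
      (branch refl (next-guess true) (next-guess false))
    where
    eq : ∀ n x y → suc (suc (n + (suc n + (x + y)))) ≡ 3 + (n + n) + x + y
    eq = solve-∀
    next-guess : ∀ k → Behaves _ _ _ (Guess (length zs) (halve k xs) Q)
    next-guess k = sweep k [] xs p
      (guessing zs (z ∷ lz) u (halve k xs) cs (≤-trans (≤-reflexive (halve-length k xs)) p)
        (+-suc-≤ (length lz) _ q) r
        (λ chosen → along (on₀ round ∘ at _)
          (cong (λ ys → items ys ++ ␣ ∷ []) (sym (revive-halve k xs))) (B chosen)))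

  -- Rounds and fuel

  module _ {N : ℕ} (ls : List Cell) (xs : List Item) (T zs : List Bool) (revived : revive xs ≡ xs)
           (xs≤N : length xs ≤ N) (T≤N : length T ≤ N) (zs≤N : length zs ≤ N) where

    private
      r : ℕ
      r = length zs

      searching : Fin 26 → Bool → Tape Cell → List Bool → List Bool → Config
      searching q u t₄ K cs =
        conf q (at (␣ ∷ ls) (items xs ++ ␣ ∷ [])) (at (␣ ∷ []) (bits K ++ ␣ ∷ []))
          (at (␣ ∷ []) (bits T ++ ␣ ∷ [])) (at (␣ ∷ []) (bits zs ++ margin u)) t₄
          (at (␣ ∷ []) (bits cs ++ ␣ ∷ []))

      finishing : ∀ cs {ls} → length cs ≤ N →
        Behaves (finalTime N) b
          (conf count t₀ t₁ (at (␣ ∷ []) (bits T ++ ␣ ∷ [])) t₃ t₄ (at ls (bits cs ++ ␣ ∷ [])))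
          (enough cs T ≡ true)
      finishing cs p = slower (+-monoˡ-≤ (2 + N) (*-monoˡ-≤ (4 + (N + N)) p)) (tally cs T T≤N)

    -- If `K` is zero the final count starts at once; `finalTime N ≤ t` lets it be charged to the
    -- time reserved for the remaining rounds.
    spending : ∀ f u K cs → length K ≤ N → length cs ≤ N → finalTime N ≤ t →
      (∀ K cs → length K ≤ N → length cs ≤ N →
        Behaves t b (searching round true t₄ K cs) (Cover r xs T f K cs)) →
      Behaves (roundTime N + t) (r + b) (searching borrowK u t₄ K cs) (Cover r xs T (suc f) K cs)
    spending {t = t} f u K cs p q F≤t B with decrement K in eq
    ... | nothing = slower (≤-trans (+-mono-≤ p (s≤s F≤t)) slack)
      (exhaust (on₁ borrowK) (λ _ _ → refl) K eq λ _ → refl ▸ finishing cs q)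
      where
      slack : N + suc t ≤ roundTime N + t
      slack = by (N + (N * (3 + (N + N)) + (5 + (N + N + (N + N))))) (eq′ N (N * (3 + (N + N))) t)
        where
        eq′ : ∀ n x t → n + suc t + (n + (x + (5 + (n + n + (n + n))))) ≡
              n + suc n + (x + (5 + (n + n + (n + n)))) + t
        eq′ = solve-∀
    ... | just K′ = slower (≤-trans (+-mono-≤ (+-monoˡ-≤ _ p) (+-monoˡ-≤ _ (*-monoˡ-≤ (3 + (N + N)) zs≤N)))
                                    (≤-reflexive (eq′ N (N * (3 + (N + N))) t)))
      (borrow (on₁ borrowK) (on₁ returnK) (on₁ guess) (λ _ _ → refl) (λ _ _ → refl)
        (λ _ _ _ → refl) (λ _ _ → refl) K [] eq p
        (guessing zs [] u xs cs xs≤N zs≤N q λ chosen →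
          along (on₀ round ∘ at (␣ ∷ ls)) (cong (λ ys → items ys ++ ␣ ∷ []) (sym revived))
            (B K′ (merge cs chosen) (≤-trans (≤-reflexive (decrement-length K eq)) p)
              (≤-trans (≤-reflexive (merge-length cs chosen)) q))))
      where
      eq′ : ∀ n x t → n + suc n + (x + (5 + (n + n + (n + n)) + t)) ≡
            n + suc n + (x + (5 + (n + n + (n + n)))) + t
      eq′ = solve-∀

    private
      P F : ℕ
      P = suc (roundTime N)
      F = finalTime N

      regroup : ∀ p f x → p + (f * suc p + x) + 1 ≡ suc f * suc p + x
      regroup = solve-∀

    looping : ∀ ws u K cs {ls′} → length K ≤ N → length cs ≤ N →
      Behaves (length ws * suc d * P + (suc (length ws) + F)) (length ws * suc d * r)
        (searching round u (at ls′ (bits ws ++ margin false)) K cs)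
        (Cover r xs T (length ws * suc d) K cs)
    -- The machine replaces `suc j` by `inject₁ j`, which is no subterm, so the recursion descends
    -- on the value `n` of `j` instead.
    refuelled : ∀ n j → toℕ j ≡ n → ∀ ws u K cs {ls′} → length K ≤ N → length cs ≤ N →
      Behaves ((n + length ws * suc d) * P + (suc (suc (length ws)) + F)) ((n + length ws * suc d) * r)
        (searching round u (at ls′ (fuel j ∷ bits ws ++ margin false)) K cs)
        (Cover r xs T (n + length ws * suc d) K cs)

    looping []       u K cs p q = refl ▸ finishing cs q
    looping (w ∷ ws) u K cs p q =
      slower (≤-reflexive (trans (+-comm 1 _) (regroup (roundTime N) (d + length ws * suc d) _)))
        (refl ▸ spending (d + length ws * suc d) u K cs p q
          (≤-trans (m≤n+m F (2 + length ws)) (m≤n+m _ ((d + length ws * suc d) * P)))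
          λ K′ cs′ p′ q′ → refuelled d (fromℕ d) (toℕ-fromℕ d) ws true K′ cs′ p′ q′)
    refuelled zero zero eq ws u K cs p q =
      slower (≤-reflexive (sym (+-suc (length ws * suc d * P) (suc (length ws) + F))))
        (refl ▸ looping ws u K cs p q)
    refuelled (suc n) (suc j) eq ws u K cs p q =
      slower (≤-reflexive (trans (+-comm 1 _) (regroup (roundTime N) (n + length ws * suc d) _)))
        (refl ▸ spending (n + length ws * suc d) u K cs p q
          (≤-trans (m≤n+m F (2 + length ws)) (m≤n+m _ ((n + length ws * suc d) * P)))
          λ K′ cs′ p′ q′ → refuelled n (inject₁ j) (trans (toℕ-inject₁ j) (suc-injective eq))
                             ws true K′ cs′ p′ q′)

  -- Measuring the family and reading the numbers

  carrying : ∀ {s} xs lz → length lz + length xs ≤ N →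
    (let x = at (␣ ∷ []) (bits lz ʳ++ (bits (increment xs) ++ margin false)) in
     Behaves t b (conf measure (at (just s ∷ ls) rs) t₁ t₂ x x t₅) A) →
    (let x = at (bits lz ++ ␣ ∷ []) (bits xs ++ margin false) in
     Behaves (length xs + suc (suc N + t)) b (conf carry (tape ls (just s) rs) t₁ t₂ x x t₅) A)
  carrying {t = t} [] lz p B =
    refl ▸ slower (s≤s (+-monoˡ-≤ t (m+n≤o⇒m≤o _ p)))
      (rewind (on₃₄ uncarry) (on₃₄ measure) (λ _ _ _ → refl) (λ _ _ → refl) (inj₁ ∘ bit) lz B)
  carrying {N = N} {t = t} (false ∷ xs) lz p B =
    slower (s≤s (m≤n+m _ (length xs)))
      (slower (n≤1+n _) (refl ▸ slower (s≤s (+-monoˡ-≤ t (m+n≤o⇒m≤o _ p)))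
        (rewind (on₃₄ uncarry) (on₃₄ measure) (λ _ _ _ → refl) (λ _ _ → refl) (inj₁ ∘ bit) lz B)))
  carrying (true ∷ xs) lz p B = refl ▸ carrying xs (false ∷ lz) (+-suc-≤ (length lz) _ p) B

  -- The bound on `length xs + length ys` persists because an increment adds at most one digit while
  -- one symbol is consumed. Tapes 3 and 4 are equal throughout, hence the single `x`.
  measuring : ∀ ys lz xs lc → length lz + length ys ≤ N → length xs + length ys ≤ N →
    length lc + length ys ≤ N →
    (let x = at (␣ ∷ []) (bits (increments (length ys) xs) ++ margin false) in
     Behaves t b (conf round (at (␣ ∷ ls) (items lz ʳ++ (items ys ++ ␣ ∷ []))) t₁ t₂ x x
       (at (␣ ∷ []) (bits lc ʳ++ (bits (List.replicate (length ys) false) ++ ␣ ∷ [])))) A) →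
    (let x = at (␣ ∷ []) (bits xs ++ margin false) in
     Behaves (length ys * (3 + (N + N)) + suc (suc N + (suc N + t))) b
       (conf measure (at (items lz ++ ␣ ∷ ls) (items ys)) t₁ t₂ x x (at (bits lc ++ ␣ ∷ []) [])) A)
  measuring [] lz xs lc p q p′ B = restart measure refl lz lc [] (m+n≤o⇒m≤o _ p) (m+n≤o⇒m≤o _ p′) B
  measuring {N = N} {t = t} (y ∷ ys) lz xs lc p q p′ B =
    slower (≤-trans (s≤s (+-monoˡ-≤ _ (m+n≤o⇒m≤o _ q)))
             (≤-reflexive (eq N (length ys * (3 + (N + N))) (suc (suc N + (suc N + t))))))
      (refl ▸ carrying xs [] (m+n≤o⇒m≤o _ q)
        (measuring ys (y ∷ lz) (increment xs) (false ∷ lc) (+-suc-≤ (length lz) _ p)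
          (≤-trans (+-monoˡ-≤ _ (increment-length xs)) (+-suc-≤ (length xs) _ q))
          (+-suc-≤ (length lc) _ p′) B))
    where
    eq : ∀ n y z → suc (n + suc (suc n + (y + z))) ≡ 3 + (n + n) + y + z
    eq = solve-∀

  -- The parameter `after` captures the one difference between reading `K` and reading `T`: whether
  -- the closing ♯ is passed or left under the head.
  reading : (L L₁ L₂ : Tape Cell → Tape Cell → Config) (after : List Cell → Tape Cell) →
    ∀ {w} →
    (∀ x {ls rs ls′} → step (L (at (␣ ∷ ls) (bitᶜ x ∷ rs)) (at ls′ [])) ≡
      next (L (at (␣ ∷ ␣ ∷ ls) rs) (at (bitᶜ x ∷ ls′) []))) →
    (∀ {ls ls′} → step (L (at (␣ ∷ ls) (♯ᶜ ∷ cells inj₁ w)) (at ls′ [])) ≡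
      next (L₁ (after ls) (atˡ ls′ (␣ ∷ [])))) →
    (∀ {ls} s ls′ rs → step (L₁ (after ls) (tape ls′ (just s) rs)) ≡
      next (L₁ (after ls) (atˡ ls′ (just s ∷ rs)))) →
    (∀ {ls} ls′ rs → step (L₁ (after ls) (tape ls′ ␣ rs)) ≡ next (L₂ (after ls) (at (␣ ∷ ls′) rs))) →
    ∀ ks lz → length lz + length ks ≤ N →
    (∀ ls → Behaves t b (L₂ (after ls) (at (␣ ∷ []) (bits lz ʳ++ (bits ks ++ ␣ ∷ [])))) A) →
    Behaves (length ks + suc (suc N + t)) b
      (L (at (␣ ∷ ls) (cells inj₁ (map bit ks ++ ♯ ∷ w))) (at (bits lz ++ ␣ ∷ []) [])) A
  reading {t = t} L L₁ L₂ after hop end hop₁ stop₁ [] lz p B =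
    end ▸ slower (s≤s (+-monoˡ-≤ t (m+n≤o⇒m≤o _ p)))
      (rewind (L₁ (after _)) (L₂ (after _)) hop₁ stop₁ (inj₁ ∘ bit) lz (B _))
  reading L L₁ L₂ after hop end hop₁ stop₁ (k ∷ ks) lz p B =
    hop k ▸ reading L L₁ L₂ after hop end hop₁ stop₁ ks (k ∷ lz) (+-suc-≤ (length lz) _ p) B

  truncated : (L : Tape Cell → Tape Cell → Config) →
    (∀ x {ls rs ls′} → step (L (at (␣ ∷ ls) (bitᶜ x ∷ rs)) (at ls′ [])) ≡
      next (L (at (␣ ∷ ␣ ∷ ls) rs) (at (bitᶜ x ∷ ls′) []))) →
    (∀ {ls ls′} → step (L (at ls []) (at ls′ [])) ≡ halt false) →
    ∀ ks {ls ls′} → Behaves (length ks) b (L (at (␣ ∷ ls) (cells inj₁ (map bit ks))) (at ls′ [])) (false ≡ true)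
  truncated L hop end []       = halt! end
  truncated L hop end (k ∷ ks) = hop k ▸ truncated L hop end ks

  items-fromSymbol : ∀ w → items (map fromSymbol w) ≡ cells inj₁ w
  items-fromSymbol []          = refl
  items-fromSymbol (bit x ∷ w) = cong (bitᶜ x ∷_) (items-fromSymbol w)
  items-fromSymbol (♯ ∷ w)     = cong (♯ᶜ ∷_) (items-fromSymbol w)

  on₀₁ : Fin 26 → {t₂ t₃ t₄ t₅ : Tape Cell} → Tape Cell → Tape Cell → Config
  on₀₁ q {t₂} {t₃} {t₄} {t₅} x y = conf q x y t₂ t₃ t₄ t₅

  on₀₂ : Fin 26 → {t₁ t₃ t₄ t₅ : Tape Cell} → Tape Cell → Tape Cell → Config
  on₀₂ q {t₁} {t₃} {t₄} {t₅} x y = conf q x t₁ y t₃ t₄ t₅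

  readK : ∀ {w} K → length K ≤ N →
    (∀ ls → Behaves t b
      (conf signT (at (␣ ∷ ls) (cells inj₁ w)) (at (␣ ∷ []) (bits K ++ ␣ ∷ []))
        (at (␣ ∷ []) []) (at (␣ ∷ []) []) (at (␣ ∷ []) []) (at (␣ ∷ []) [])) A) →
    Behaves (suc (N + suc (suc N + t))) b (initial (bit false ∷ map bit K ++ ♯ ∷ w)) A
  readK {w = w} K p B = refl ▸ slower (+-monoˡ-≤ _ p)
    (reading (on₀₁ digitsK) (on₀₁ rewindK) (on₀₁ signT) (λ ls → at (␣ ∷ ␣ ∷ ls) (cells inj₁ w))
      (λ _ → refl) refl (λ _ _ _ → refl) (λ _ _ → refl) K [] p λ _ → B _)

  module _ (w : List Symbol) where
    bitBound : ℕ
    bitBound = length (counter w) * suc d * length (counter w)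

    Search : List Bool → List Bool → Set
    Search K T = Cover (length (counter w)) (blocks w) T (length (counter w) * suc d) K
                   (List.replicate (length (blocks w)) false)

    afterDigits : ∀ K T → length K ≤ N → length T ≤ N → suc (length w) ≤ N →
      Behaves (N * (3 + (N + N)) + suc (suc N + (suc N + loopTime d N))) bitBound
        (conf measure (at (␣ ∷ ls) (cells inj₁ (♯ ∷ w))) (at (␣ ∷ []) (bits K ++ ␣ ∷ []))
          (at (␣ ∷ []) (bits T ++ ␣ ∷ [])) (at (␣ ∷ []) []) (at (␣ ∷ []) []) (at (␣ ∷ []) []))
        (Search K T)
    afterDigits {N = N} {ls = ls} K T p q r =
      slower (+-mono-≤ (*-monoˡ-≤ (3 + (N + N)) r′)
        (s≤s (s≤s (+-monoʳ-≤ N (s≤s (+-monoʳ-≤ N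
          (+-mono-≤ (*-monoˡ-≤ (suc (roundTime N)) (*-monoˡ-≤ (suc d) c≤N))
                    (s≤s (+-monoˡ-≤ (finalTime N) c≤N)))))))))
        (along (λ x → conf measure (at (␣ ∷ ls) x) (at (␣ ∷ []) (bits K ++ ␣ ∷ []))
                 (at (␣ ∷ []) (bits T ++ ␣ ∷ [])) (at (␣ ∷ []) []) (at (␣ ∷ []) []) (at (␣ ∷ []) []))
          (items-fromSymbol (♯ ∷ w))
          (measuring (blocks w) [] [] [] r′ r′ r′
            (looping ls (blocks w) T (counter w) (revive-fromSymbol (♯ ∷ w)) r′ q c≤N (counter w) false K
              (List.replicate (length (blocks w)) false) p
              (≤-trans (≤-reflexive (length-replicate (length (blocks w)))) r′))))
      where
      r′ : length (blocks w) ≤ N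
      r′ = ≤-trans (≤-reflexive (length-map fromSymbol (♯ ∷ w))) r

      c≤N : length (counter w) ≤ N
      c≤N = ≤-trans (increments-length (length (blocks w)) []) (≤-trans (≤-reflexive (+-identityʳ _)) r′)

    -- The string `w` is arbitrary: `Search` is defined by marks and bits alone, so one statement
    -- yields both correctness on encodings and the bounds on all other strings with a complete
    -- header.
    valid : ∀ K T → length K ≤ N → length T ≤ N → suc (length w) ≤ N →
      Behaves (totalTime d N) bitBound
        (initial (bit false ∷ map bit K ++ ♯ ∷ bit false ∷ map bit T ++ ♯ ∷ w)) (Search K T)
    valid K T p q r = readK K p λ _ → refl ▸ slower (+-monoˡ-≤ _ q)
      (reading (on₀₂ digitsT) (on₀₂ rewindT) (on₀₂ measure) (λ ls → at (␣ ∷ ls) (cells inj₁ (♯ ∷ w)))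
        (λ _ → refl) refl (λ _ _ _ → refl) (λ _ _ → refl) T [] q λ _ → afterDigits K T p q r)

  -- Resource bounds on arbitrary strings

  data Numeral : List Symbol → Set where
    unended : ∀ K → Numeral (map bit K)
    ended   : ∀ K w → Numeral (map bit K ++ ♯ ∷ w)

  numeral : ∀ w → Numeral w
  numeral []          = unended []
  numeral (♯ ∷ w)     = ended [] w
  numeral (bit x ∷ w) with numeral w
  ... | unended K = unended (x ∷ K)
  ... | ended K w = ended (x ∷ K) w

  digits-≤ : ∀ (K : List Bool) v → length K ≤ length (map bit K ++ v)
  digits-≤ K v = ≤-trans (≤-reflexive (sym (length-map bit K)))
    (≤-trans (m≤m+n _ (length v)) (≤-reflexive (sym (length-++ (map bit K)))))

  rest-≤ : ∀ (u v : List Symbol) → length v ≤ length (u ++ v)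
  rest-≤ u v = ≤-trans (m≤n+m (length v) (length u)) (≤-reflexive (sym (length-++ u)))

  bitBudget : ℕ → ℕ
  bitBudget n = suc ⌊log₂ n ⌋ * suc d * suc ⌊log₂ n ⌋

  bitBound-≤ : ∀ w → suc (length w) ≤ N → bitBound w ≤ bitBudget N
  bitBound-≤ {N = N} w p = *-mono-≤ (*-monoˡ-≤ (suc d) c≤) c≤
    where
    c≤ : length (counter w) ≤ suc ⌊log₂ N ⌋
    c≤ = ≤-trans (increments-log (length (map fromSymbol w)))
      (s≤s (⌊log₂⌋-mono-≤ {length (blocks w)} {N}
        (≤-trans (≤-reflexive (cong suc (length-map fromSymbol w))) p)))

  bounded : ∀ w → HaltsWithin (totalTime d (length w)) (bitBudget (length w)) (initial w)
  bounded []               = halting (halt! {b = bitBudget 0} refl)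
  bounded (♯ ∷ w)          = halting (halt! refl)
  bounded (bit true ∷ w)   = halting (halt! refl)
  bounded (bit false ∷ w)  with numeral w
  ... | unended K = halting {b = bitBudget L} (refl ▸ slower
          (≤-trans (≤-trans (≤-reflexive (sym (length-map bit K))) (n≤1+n _)) (m≤m+n L _))
          (truncated (on₀₁ digitsK) (λ _ → refl) refl K))
    where
    L : ℕ
    L = suc (length (map bit K))
  ... | ended K w₁ = afterK w₁ ≤-refl
    where
    L : ℕ
    L = suc (length (map bit K ++ ♯ ∷ w₁))

    K≤L : length K ≤ L
    K≤L = m≤n⇒m≤1+n (digits-≤ K _)

    -- The bound `L` belongs to the whole input and stays fixed while the cases refine `v`, so `v`
    -- is tied to the input by its length alone.
    afterK : ∀ v → length v ≤ length w₁ → HaltsWithin (totalTime d L) (bitBudget L)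
      (initial (bit false ∷ map bit K ++ ♯ ∷ v))
    afterK []              _ = halting (readK K K≤L λ _ → halt! {b = bitBudget L} refl)
    afterK (♯ ∷ v)         _ = halting (readK K K≤L λ _ → halt! {b = bitBudget L} refl)
    afterK (bit true ∷ v)  _ = halting (readK K K≤L λ _ → halt! {b = bitBudget L} refl)
    afterK (bit false ∷ v) p with numeral v
    ... | unended T = halting (readK K K≤L λ _ → refl ▸ slower
            (≤-trans T≤L (m≤m+n L _))
            (truncated {b = bitBudget L} (on₀₂ digitsT) (λ _ → refl) refl T))
      where
      T≤L : length T ≤ L
      T≤L = ≤-trans (≤-reflexive (sym (length-map bit T))) (≤-trans (n≤1+n _) (≤-trans p
              (≤-trans (n≤1+n _) (≤-trans (rest-≤ (map bit K) _) (n≤1+n _)))))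
    ... | ended T w₂ = halting (within ≤-refl (bitBound-≤ w₂ (≤-trans (rest-≤ (map bit T) _) v≤L))
            (valid w₂ K T K≤L (≤-trans (digits-≤ T _) v≤L) (≤-trans (rest-≤ (map bit T) _) v≤L)))
      where
      v≤L : length (map bit T ++ ♯ ∷ w₂) ≤ L
      v≤L = ≤-trans (n≤1+n _) (≤-trans p
              (≤-trans (n≤1+n _) (≤-trans (rest-≤ (map bit K) _) (n≤1+n _))))

-- Soundness and completeness of guesses

decrement-just : ∀ xs {ys} → decrement xs ≡ just ys → value xs ≡ suc (value ys)
decrement-just (true ∷ xs)  refl = refl
decrement-just (false ∷ xs) eq with decrement xs in eq′
decrement-just (false ∷ xs) refl | just ys =
  trans (cong (2 *_) (decrement-just xs eq′)) (*-suc 2 (value ys))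

decrement-nothing : ∀ xs → decrement xs ≡ nothing → value xs ≡ 0
decrement-nothing []           eq = refl
decrement-nothing (false ∷ xs) eq with decrement xs in eq′
... | nothing = cong (2 *_) (decrement-nothing xs eq′)

isZero-sound : ∀ xs → isZero xs ≡ true → value xs ≡ 0
isZero-sound []           eq = refl
isZero-sound (false ∷ xs) eq = cong (2 *_) (isZero-sound xs eq)

isZero-complete : ∀ xs → value xs ≡ 0 → isZero xs ≡ true
isZero-complete []           eq = refl
isZero-complete (false ∷ xs) eq = isZero-complete xs (m+n≡0⇒m≡0 (value xs) eq)

trues : List Bool → ℕ
trues []           = 0
trues (true ∷ cs)  = suc (trues cs)
trues (false ∷ cs) = trues cs

enough-sound : ∀ cs T → enough cs T ≡ true → value T ≤ trues cs
enough-sound []           T eq = ≤-reflexive (isZero-sound T eq)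
enough-sound (false ∷ cs) T eq = enough-sound cs T eq
enough-sound (true ∷ cs)  T eq with decrement T in eq′
... | nothing = ≤-trans (≤-reflexive (decrement-nothing T eq′)) z≤n
... | just T′ = ≤-trans (≤-reflexive (decrement-just T eq′)) (s≤s (enough-sound cs T′ eq))

enough-complete : ∀ cs T → value T ≤ trues cs → enough cs T ≡ true
enough-complete []           T p = isZero-complete T (n≤0⇒n≡0 p)
enough-complete (false ∷ cs) T p = enough-complete cs T p
enough-complete (true ∷ cs)  T p with decrement T in eq′
... | nothing = refl
... | just T′ = enough-complete cs T′ (≤-pred (≤-trans (≤-reflexive (sym (decrement-just T eq′))) p))

module _ {r : ℕ} {xs : List Item} (T : List Bool) {S : List Bool → Set}
  (sound : ∀ {Q} → Guess r xs Q → ∃ λ s → S s × Q s)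
  (complete : ∀ {Q : List Bool → Set} {s} → S s → Q s → Guess r xs Q) where

  Cover-sound : ∀ f K cs → Cover r xs T f K cs →
    ∃ λ ss → length ss ≤ value K × All S ss × value T ≤ trues (List.foldl merge cs ss)
  Cover-sound zero    K cs c = [] , z≤n , [] , enough-sound cs T c
  Cover-sound (suc f) K cs c with decrement K in eq
  ... | nothing = [] , z≤n , [] , enough-sound cs T c
  ... | just K′ =
    let s , Ss , c′ = sound c
        ss , p , Sss , q = Cover-sound f K′ (merge cs s) c′
    in s ∷ ss , ≤-trans (s≤s p) (≤-reflexive (sym (decrement-just K eq))) , Ss ∷ Sss , q

  -- The machine guesses until the fuel or `K` runs out, even when `ss` is shorter. The surplus
  -- guesses choose the empty set, which `S []` admits and `merge-[]` shows to be neutral.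
  Cover-complete : S [] → ∀ f K cs {ss} → length ss ≤ f → length ss ≤ value K → All S ss →
    value T ≤ trues (List.foldl merge cs ss) → Cover r xs T f K cs
  Cover-complete S[] zero K cs {[]} p q Sss e = enough-complete cs T e
  Cover-complete S[] (suc f) K cs {ss} p q Sss e with decrement K in eq
  Cover-complete S[] (suc f) K cs {[]} p q Sss e | nothing = enough-complete cs T e
  Cover-complete S[] (suc f) K cs {_ ∷ _} p q Sss e | nothing
    with () ← ≤-trans q (≤-reflexive (decrement-nothing K eq))
  Cover-complete S[] (suc f) K cs {[]} p q [] e | just K′ =
    complete S[] (Cover-complete S[] f K′ (merge cs []) {[]} z≤n z≤n []
      (subst (λ cs → value T ≤ trues cs) (sym (merge-[] cs)) e))
  Cover-complete S[] (suc f) K cs {s ∷ ss} (s≤s p) q (Ss ∷ Sss) e | just K′ =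
    complete Ss (Cover-complete S[] f K′ (merge cs s) p
      (≤-pred (≤-trans q (≤-reflexive (decrement-just K eq)))) Sss e)

Block : Set
Block = Bool × List Bool

flatten : List Block → List Item
flatten []             = []
flatten ((a , s) ∷ bs) = mark a ∷ map elem s ++ flatten bs

halveᵇ : Bool → List Block → List Block
halveᵇ k []                 = []
halveᵇ k ((true , s) ∷ bs)  = (k , s) ∷ halveᵇ (not k) bs
halveᵇ k ((false , s) ∷ bs) = (false , s) ∷ halveᵇ k bs

pickedᵇ : List Block → List Bool
pickedᵇ []                 = []
pickedᵇ ((true , s) ∷ bs)  = s
pickedᵇ ((false , s) ∷ bs) = pickedᵇ bs

live : List Block → ℕ
live []                 = 0
live ((true , s) ∷ bs)  = suc (live bs)
live ((false , s) ∷ bs) = live bs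

halve-elems : ∀ k s xs → halve k (map elem s ++ xs) ≡ map elem s ++ halve k xs
halve-elems k []      xs = refl
halve-elems k (x ∷ s) xs = cong (elem x ∷_) (halve-elems k s xs)

halve-flatten : ∀ k bs → halve k (flatten bs) ≡ flatten (halveᵇ k bs)
halve-flatten k []                 = refl
halve-flatten k ((true , s) ∷ bs)  =
  cong (mark k ∷_) (trans (halve-elems (not k) s _) (cong (map elem s ++_) (halve-flatten (not k) bs)))
halve-flatten k ((false , s) ∷ bs) =
  cong (mark false ∷_) (trans (halve-elems k s _) (cong (map elem s ++_) (halve-flatten k bs)))

picked-elems : ∀ s xs → picked (map elem s ++ xs) ≡ picked xs
picked-elems []      xs = refl
picked-elems (x ∷ s) xs = picked-elems s xs

leading-flatten : ∀ s bs → leading (map elem s ++ flatten bs) ≡ s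
leading-flatten []      []       = refl
leading-flatten []      (b ∷ bs) = refl
leading-flatten (x ∷ s) bs       = cong (x ∷_) (leading-flatten s bs)

picked-flatten : ∀ bs → picked (flatten bs) ≡ pickedᵇ bs
picked-flatten []                 = refl
picked-flatten ((true , s) ∷ bs)  = leading-flatten s bs
picked-flatten ((false , s) ∷ bs) = trans (picked-elems s _) (picked-flatten bs)

halveᵇ-sets : ∀ k bs → map proj₂ (halveᵇ k bs) ≡ map proj₂ bs
halveᵇ-sets k []                 = refl
halveᵇ-sets k ((true , s) ∷ bs)  = cong (s ∷_) (halveᵇ-sets (not k) bs)
halveᵇ-sets k ((false , s) ∷ bs) = cong (s ∷_) (halveᵇ-sets k bs)

pickedᵇ-∈ : ∀ bs → pickedᵇ bs ≡ [] ⊎ pickedᵇ bs ∈ˡ map proj₂ bs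
pickedᵇ-∈ []                 = inj₁ refl
pickedᵇ-∈ ((true , s) ∷ bs)  = inj₂ (here refl)
pickedᵇ-∈ ((false , s) ∷ bs) = Sum.map₂ there (pickedᵇ-∈ bs)

-- Some branches strike out every block and then pick nothing; the membership of `[]` makes this a
-- legitimate choice too.
Guess-sound : ∀ r bs {Q} → [] ∈ˡ map proj₂ bs → Guess r (flatten bs) Q →
  ∃ λ s → s ∈ˡ map proj₂ bs × Q s
Guess-sound zero bs {Q} []∈ q =
  pickedᵇ bs , [ (λ eq → subst (_∈ˡ map proj₂ bs) (sym eq) []∈) , id ]′ (pickedᵇ-∈ bs) ,
  subst Q (picked-flatten bs) q
Guess-sound (suc r) bs {Q} []∈ = [ go true , go false ]′
  where
  go : ∀ k → Guess r (halve k (flatten bs)) Q → ∃ λ s → s ∈ˡ map proj₂ bs × Q s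
  go k g rewrite halve-flatten k bs | sym (halveᵇ-sets k bs) = Guess-sound r (halveᵇ k bs) []∈ g

-- The two counts are proved together because every live block swaps the roles of the two flags, and
-- with them rounding up and rounding down.
live-halve : ∀ bs → live (halveᵇ true bs) ≡ ⌈ live bs /2⌉ × live (halveᵇ false bs) ≡ ⌊ live bs /2⌋
live-halve []                 = refl , refl
live-halve ((true , s) ∷ bs)  = let p , q = live-halve bs in cong suc q , p
live-halve ((false , s) ∷ bs) = live-halve bs

survives : ∀ k {s} bs → (true , s) ∈ˡ bs → (true , s) ∈ˡ halveᵇ k bs ⊎ (true , s) ∈ˡ halveᵇ (not k) bs
survives true  ((true , s) ∷ bs)  (here refl) = inj₁ (here refl)
survives false ((true , s) ∷ bs)  (here refl) = inj₂ (here refl)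
survives true  ((true , s) ∷ bs)  (there p)   = Sum.map there there (survives false bs p)
survives false ((true , s) ∷ bs)  (there p)   = Sum.map there there (survives true bs p)
survives k     ((false , s) ∷ bs) (there p)   = Sum.map there there (survives k bs p)

live-∈ : ∀ {s} bs → (true , s) ∈ˡ bs → 1 ≤ live bs
live-∈ ((true , s) ∷ bs)  p         = s≤s z≤n
live-∈ ((false , s) ∷ bs) (there p) = live-∈ bs p

pickedᵇ-unique : ∀ {s} bs → (true , s) ∈ˡ bs → live bs ≤ 1 → pickedᵇ bs ≡ s
pickedᵇ-unique ((true , s) ∷ bs)  (here refl) l = refl
pickedᵇ-unique ((true , s) ∷ bs)  (there p) (s≤s l) with () ← ≤-trans (live-∈ bs p) l
pickedᵇ-unique ((false , s) ∷ bs) (there p) l = pickedᵇ-unique bs p l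

-- The correct bit is the one under which the wanted block survives (`survives`). Even rounded up,
-- half of `2 ^ suc r` is `2 ^ r`, so in the end the wanted block is the only live one.
Guess-complete : ∀ r bs {Q s} → live bs ≤ 2 ^ r → (true , s) ∈ˡ bs → Q s → Guess r (flatten bs) Q
Guess-complete zero bs {Q} l p q =
  subst Q (sym (trans (picked-flatten bs) (pickedᵇ-unique bs p l))) q
Guess-complete (suc r) bs {Q} l p q =
  Sum.map (go true (≤-trans (≤-reflexive (proj₁ (live-halve bs))) half))
          (go false (≤-trans (≤-reflexive (proj₂ (live-halve bs))) (≤-trans (⌊n/2⌋≤⌈n/2⌉ (live bs)) half)))
          (survives true bs p)
  where
  half : ⌈ live bs /2⌉ ≤ 2 ^ r
  half = ≤-trans (⌈n/2⌉-mono l) (≤-reflexive (trans (cong (λ n → ⌈ 2 ^ r + n /2⌉) (+-identityʳ (2 ^ r)))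
           (sym (n≡⌈n+n/2⌉ (2 ^ r)))))
  go : ∀ k → live (halveᵇ k bs) ≤ 2 ^ r → (true , _) ∈ˡ halveᵇ k bs → Guess r (halve k (flatten bs)) Q
  go k l p rewrite halve-flatten k bs = Guess-complete r (halveᵇ k bs) l p q

-- Greedy covers

private variable
  n m k : ℕ

⋃-complete : ∀ (p : Subset n) ps {x} → p ∈ˡ ps → x ∈ˢ p → x ∈ˢ ⋃ ps
⋃-complete p (_ ∷ ps) (here refl) x∈ = x∈p∪q⁺ (inj₁ x∈)
⋃-complete p (_ ∷ ps) (there p∈)  x∈ = x∈p∪q⁺ (inj₂ (⋃-complete p ps p∈ x∈))

⋃-sound : ∀ (ps : List (Subset n)) {x} → x ∈ˢ ⋃ ps → ∃ λ p → p ∈ˡ ps × x ∈ˢ p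
⋃-sound []       x∈ = contradiction x∈ ∉⊥
⋃-sound (p ∷ ps) x∈ with x∈p∪q⁻ p (⋃ ps) x∈
... | inj₁ x∈p = p , here refl , x∈p
... | inj₂ x∈  = let q , q∈ , x∈q = ⋃-sound ps x∈ in q , there q∈ , x∈q

elements : Subset n → List (Fin n)
elements []          = []
elements (true ∷ p)  = zero ∷ map suc (elements p)
elements (false ∷ p) = map suc (elements p)

elements-length : ∀ (p : Subset n) → length (elements p) ≡ ∣ p ∣
elements-length []          = refl
elements-length (true ∷ p)  = cong suc (trans (length-map suc (elements p)) (elements-length p))
elements-length (false ∷ p) = trans (length-map suc (elements p)) (elements-length p)

∈-elements : ∀ (p : Subset n) {x} → x ∈ˢ p → x ∈ˡ elements p
∈-elements (true ∷ p)  Vec.here       = here refl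
∈-elements (true ∷ p)  (Vec.there x∈) = there (∈-map⁺ suc (∈-elements p x∈))
∈-elements (false ∷ p) (Vec.there x∈) = ∈-map⁺ suc (∈-elements p x∈)

∣p∪q∣≤∣p∣+∣q∣ : ∀ (p q : Subset n) → ∣ p ∪ q ∣ ≤ ∣ p ∣ + ∣ q ∣
∣p∪q∣≤∣p∣+∣q∣ []          []          = z≤n
∣p∪q∣≤∣p∣+∣q∣ (true ∷ p)  (true ∷ q)  =
  s≤s (≤-trans (∣p∪q∣≤∣p∣+∣q∣ p q) (+-monoʳ-≤ ∣ p ∣ (n≤1+n ∣ q ∣)))
∣p∪q∣≤∣p∣+∣q∣ (true ∷ p)  (false ∷ q) = s≤s (∣p∪q∣≤∣p∣+∣q∣ p q)
∣p∪q∣≤∣p∣+∣q∣ (false ∷ p) (true ∷ q)  =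
  ≤-trans (s≤s (∣p∪q∣≤∣p∣+∣q∣ p q)) (≤-reflexive (sym (+-suc ∣ p ∣ ∣ q ∣)))
∣p∪q∣≤∣p∣+∣q∣ (false ∷ p) (false ∷ q) = ∣p∪q∣≤∣p∣+∣q∣ p q

fromElements : List (Fin n) → Subset n
fromElements = ⋃ ∘ map ⁅_⁆

-- Only an inequality, since a list of guesses may repeat an index.
∣fromElements∣ : ∀ (is : List (Fin n)) → ∣ fromElements is ∣ ≤ length is
∣fromElements∣ {n} []       = ≤-reflexive (∣⊥∣≡0 n)
∣fromElements∣     (i ∷ is) = ≤-trans (∣p∪q∣≤∣p∣+∣q∣ ⁅ i ⁆ (fromElements is))
  (+-mono-≤ (≤-reflexive (∣⁅x⁆∣≡1 i)) (∣fromElements∣ is))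

∈-fromElements : ∀ {is : List (Fin n)} {i} → i ∈ˡ is → i ∈ˢ fromElements is
∈-fromElements {is = is} {i} i∈ = ⋃-complete ⁅ i ⁆ (map ⁅_⁆ is) (∈-map⁺ ⁅_⁆ i∈) (x∈⁅x⁆ i)

∣∁p∣-split : ∀ (p q : Subset n) → ∣ ∁ p ∣ ≡ ∣ ∁ p ∩ q ∣ + ∣ ∁ (p ∪ q) ∣
∣∁p∣-split []          []          = refl
∣∁p∣-split (true ∷ p)  (_ ∷ q)     = ∣∁p∣-split p q
∣∁p∣-split (false ∷ p) (true ∷ q)  = cong suc (∣∁p∣-split p q)
∣∁p∣-split (false ∷ p) (false ∷ q) = trans (cong suc (∣∁p∣-split p q)) (sym (+-suc _ _))

-- Weights count the incidences of elements and sets in two ways.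
weight : Subset n → (Fin n → ℕ) → ℕ
weight []          g = 0
weight (true ∷ p)  g = g zero + weight p (g ∘ suc)
weight (false ∷ p) g = weight p (g ∘ suc)

indicator : Subset n → Fin n → ℕ
indicator p x = if does (x ∈? p) then 1 else 0

weight-zero : ∀ (p : Subset n) → weight p (λ _ → 0) ≡ 0
weight-zero []          = refl
weight-zero (true ∷ p)  = weight-zero p
weight-zero (false ∷ p) = weight-zero p

weight-+ : ∀ (p : Subset n) g h → weight p (λ x → g x + h x) ≡ weight p g + weight p h
weight-+ []          g h = refl
weight-+ (false ∷ p) g h = weight-+ p (g ∘ suc) (h ∘ suc)
weight-+ (true ∷ p)  g h = trans (cong (λ z → g zero + h zero + z) (weight-+ p (g ∘ suc) (h ∘ suc)))
  (interchange (g zero) (h zero) (weight p (g ∘ suc)) (weight p (h ∘ suc)))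
  where
  interchange : ∀ a b c d → a + b + (c + d) ≡ a + c + (b + d)
  interchange = solve-∀

weight-cong : ∀ (p : Subset n) {g h} → (∀ x → g x ≡ h x) → weight p g ≡ weight p h
weight-cong []          eq = refl
weight-cong (true ∷ p)  eq = cong₂ _+_ (eq zero) (weight-cong p (eq ∘ suc))
weight-cong (false ∷ p) eq = weight-cong p (eq ∘ suc)

weight-lower : ∀ (p : Subset n) c {g m} → (∀ x → m ≤ c * g x) → m * ∣ p ∣ ≤ c * weight p g
weight-lower []          c {m = m} le = ≤-reflexive (trans (*-zeroʳ m) (sym (*-zeroʳ c)))
weight-lower (false ∷ p) c le = weight-lower p c (le ∘ suc)
weight-lower (true ∷ p)  c {g} {m} le = begin
  m * suc ∣ p ∣                         ≡⟨ *-suc m ∣ p ∣ ⟩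
  m + m * ∣ p ∣                         ≤⟨ +-mono-≤ (le zero) (weight-lower p c (le ∘ suc)) ⟩
  c * g zero + c * weight p (g ∘ suc)   ≡⟨ *-distribˡ-+ c (g zero) _ ⟨
  c * (g zero + weight p (g ∘ suc))     ∎
  where open ≤-Reasoning

weight-indicator : ∀ (p q : Subset n) → weight p (indicator q) ≡ ∣ p ∩ q ∣
weight-indicator []          []          = refl
weight-indicator (true ∷ p)  (true ∷ q)  = cong suc (weight-indicator p q)
weight-indicator (true ∷ p)  (false ∷ q) = weight-indicator p q
weight-indicator (false ∷ p) (_ ∷ q)     = weight-indicator p q

incidences : ∀ (p : Subset n) (sets : Vec (Subset n) m) →
  weight p (λ x → Vec.count (x ∈?_) sets) ≡ Vec.sum (Vec.map (λ s → ∣ p ∩ s ∣) sets)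
incidences p []         = weight-zero p
incidences p (s ∷ sets) = begin
  weight p (λ x → Vec.count (x ∈?_) (s ∷ sets))                ≡⟨ weight-cong p split ⟩
  weight p (λ x → indicator s x + Vec.count (x ∈?_) sets)      ≡⟨ weight-+ p (indicator s) _ ⟩
  weight p (indicator s) + weight p (λ x → Vec.count (x ∈?_) sets)
    ≡⟨ cong₂ _+_ (weight-indicator p s) (incidences p sets) ⟩
  ∣ p ∩ s ∣ + Vec.sum (Vec.map (λ s → ∣ p ∩ s ∣) sets)         ∎
  where
  open ≡-Reasoning
  split : ∀ x → Vec.count (x ∈?_) (s ∷ sets) ≡ indicator s x + Vec.count (x ∈?_) sets
  split x with does (x ∈? s)
  ... | true  = refl
  ... | false = refl

-- Averaging without division: if the first set falls short, its scaled value is at most `u`, and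
-- cancelling `u` leaves the same inequality for the other sets.
average : ∀ (g : Subset n → ℕ) c u .{{_ : NonZero m}} (sets : Vec (Subset n) m) →
  m * u ≤ c * Vec.sum (Vec.map g sets) → ∃ λ i → u ≤ c * g (lookup sets i)
average g c u (s ∷ sets) le with ≤-total u (c * g s)
average g c u (s ∷ sets) le | inj₁ u≤ = zero , u≤
average g c u (s ∷ []) le | inj₂ _ =
  zero , ≤-trans (≤-reflexive (sym (+-identityʳ u))) (≤-trans le (≤-reflexive (cong (c *_) (+-identityʳ (g s)))))
average g c u (s ∷ sets@(_ ∷ _)) le | inj₂ ≤u =
  let i , u≤ = average g c u sets (+-cancelˡ-≤ u _ _ (≤-trans le (≤-trans
                 (≤-reflexive (*-distribˡ-+ c (g s) _)) (+-monoˡ-≤ _ ≤u))))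
  in suc i , u≤

module _ (sets : Vec (Subset n) m) where

  add : Subset n → Fin m → Subset n
  add U i = U ∪ lookup sets i

  cover : Subset n → List (Fin m) → Subset n
  cover = List.foldl add

  cover-sound : ∀ U is {x} → x ∈ˢ cover U is → x ∈ˢ U ⊎ (∃ λ i → i ∈ˡ is × x ∈ˢ lookup sets i)
  cover-sound U []       x∈ = inj₁ x∈
  cover-sound U (i ∷ is) x∈ with cover-sound (add U i) is x∈
  ... | inj₂ (j , j∈ , x∈j) = inj₂ (j , there j∈ , x∈j)
  ... | inj₁ x∈U∪i with x∈p∪q⁻ U (lookup sets i) x∈U∪i
  ...   | inj₁ x∈U = inj₁ x∈U
  ...   | inj₂ x∈i = inj₂ (i , here refl , x∈i)

  cover-⊇ : ∀ U is {x} → x ∈ˢ U → x ∈ˢ cover U is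
  cover-⊇ U []       x∈ = x∈
  cover-⊇ U (i ∷ is) x∈ = cover-⊇ (add U i) is (x∈p∪q⁺ (inj₁ x∈))

  cover-complete : ∀ U is {i x} → i ∈ˡ is → x ∈ˢ lookup sets i → x ∈ˢ cover U is
  cover-complete U (i ∷ is) (here refl) x∈ = cover-⊇ (add U i) is (x∈p∪q⁺ (inj₂ x∈))
  cover-complete U (i ∷ is) (there i∈)  x∈ = cover-complete (add U i) is i∈ x∈

  -- Averaging is applied to the incidences with uncovered elements only. The factor `1 - 1/c`
  -- appears with its denominator cleared.
  improve : ∀ d .{{_ : NonZero m}} → (∀ x → m ≤ suc d * Vec.count (x ∈?_) sets) →
    ∀ U → ∃ λ i → suc d * ∣ ∁ (add U i) ∣ ≤ d * ∣ ∁ U ∣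
  improve d dense U =
    let i , le = average (λ s → ∣ ∁ U ∩ s ∣) (suc d) ∣ ∁ U ∣ sets
                   (≤-trans (weight-lower (∁ U) (suc d) dense) (≤-reflexive (cong (suc d *_) (incidences (∁ U) sets))))
    in i , shrink ∣ ∁ U ∩ lookup sets i ∣ ∣ ∁ (add U i) ∣ (∣∁p∣-split U (lookup sets i)) le
    where
    shrink : ∀ a b {u} → u ≡ a + b → u ≤ suc d * a → suc d * b ≤ d * u
    shrink a b {u} eq le = +-cancelʳ-≤ u _ _ (begin
      suc d * b + u         ≤⟨ +-monoʳ-≤ (suc d * b) le ⟩
      suc d * b + suc d * a ≡⟨ +-comm (suc d * b) _ ⟩
      suc d * a + suc d * b ≡⟨ *-distribˡ-+ (suc d) a b ⟨
      suc d * (a + b)       ≡⟨ cong (suc d *_) eq ⟨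
      suc d * u             ≡⟨ +-comm u (d * u) ⟩
      d * u + u             ∎)
      where open ≤-Reasoning

  greedy : ∀ d .{{_ : NonZero m}} → (∀ x → m ≤ suc d * Vec.count (x ∈?_) sets) →
    ∀ f U → ∃ λ is → length is ≡ f × suc d ^ f * ∣ ∁ (cover U is) ∣ ≤ d ^ f * ∣ ∁ U ∣
  greedy d dense zero    U = [] , refl , ≤-refl
  greedy d dense (suc f) U =
    let i , le        = improve d dense U
        is , eq , le′ = greedy d dense f (add U i)
    in i ∷ is , cong suc eq , (begin
      suc d ^ suc f * ∣ ∁ (cover U (i ∷ is)) ∣      ≡⟨ *-assoc (suc d) (suc d ^ f) _ ⟩
      suc d * (suc d ^ f * ∣ ∁ (cover U (i ∷ is)) ∣) ≤⟨ *-monoʳ-≤ (suc d) le′ ⟩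
      suc d * (d ^ f * ∣ ∁ (add U i) ∣)             ≡⟨ swap (suc d) (d ^ f) _ ⟩
      d ^ f * (suc d * ∣ ∁ (add U i) ∣)             ≤⟨ *-monoʳ-≤ (d ^ f) le ⟩
      d ^ f * (d * ∣ ∁ U ∣)                         ≡⟨ regroup (d ^ f) d ∣ ∁ U ∣ ⟩
      d ^ suc f * ∣ ∁ U ∣                           ∎)
    where
    open ≤-Reasoning
    swap : ∀ a b c → a * (b * c) ≡ b * (a * c)
    swap = solve-∀
    regroup : ∀ a b c → a * (b * c) ≡ b * a * c
    regroup = solve-∀

-- This is `(1 + 1/d)^k ≥ 1 + k/d`, multiplied by `d ^ suc k`.
bernoulli : ∀ d k → d ^ k * (d + k) ≤ d * suc d ^ k
bernoulli d zero    = ≤-reflexive (trans (+-identityʳ _) (trans (+-identityʳ d) (sym (*-identityʳ d))))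
bernoulli d (suc k) = begin
  d ^ suc k * (d + suc k)      ≤⟨ m≤m+n _ (d ^ k * k) ⟩
  d * d ^ k * (d + suc k) + d ^ k * k ≡⟨ expand d k (d ^ k) ⟩
  suc d * (d ^ k * (d + k))    ≤⟨ *-monoʳ-≤ (suc d) (bernoulli d k) ⟩
  suc d * (d * suc d ^ k)      ≡⟨ swap (suc d) d (suc d ^ k) ⟩
  d * suc d ^ suc k            ∎
  where
  open ≤-Reasoning
  expand : ∀ d k x → d * x * (d + suc k) + x * k ≡ suc d * (x * (d + k))
  expand = solve-∀
  swap : ∀ a b x → a * (b * x) ≡ b * (a * x)
  swap = solve-∀

-- (1 - 1/c)ᶜ ≤ 1/2, for c = suc d.
halved : ∀ d .{{_ : NonZero d}} → 2 * d ^ suc d ≤ suc d ^ suc d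
halved d = *-cancelˡ-≤ d (begin
  d * (2 * d ^ suc d)           ≤⟨ m≤m+n _ (d ^ suc d) ⟩
  d * (2 * d ^ suc d) + d ^ suc d ≡⟨ expand d (d ^ suc d) ⟩
  d ^ suc d * (d + suc d)       ≤⟨ bernoulli d (suc d) ⟩
  d * suc d ^ suc d             ∎)
  where
  open ≤-Reasoning
  expand : ∀ d x → d * (2 * x) + x ≡ x * (d + suc d)
  expand = solve-∀

halved^ : ∀ d .{{_ : NonZero d}} r → 2 ^ r * d ^ (r * suc d) ≤ suc d ^ (r * suc d)
halved^ d zero    = ≤-refl
halved^ d (suc r) = begin
  2 * 2 ^ r * d ^ (suc d + r * suc d)           ≡⟨ cong (2 * 2 ^ r *_) (^-distribˡ-+-* d (suc d) (r * suc d)) ⟩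
  2 * 2 ^ r * (d ^ suc d * d ^ (r * suc d))     ≡⟨ interchange 2 (2 ^ r) (d ^ suc d) (d ^ (r * suc d)) ⟩
  2 * d ^ suc d * (2 ^ r * d ^ (r * suc d))     ≤⟨ *-mono-≤ (halved d) (halved^ d r) ⟩
  suc d ^ suc d * suc d ^ (r * suc d)           ≡⟨ ^-distribˡ-+-* (suc d) (suc d) (r * suc d) ⟨
  suc d ^ (suc d + r * suc d)                   ∎
  where
  open ≤-Reasoning
  interchange : ∀ a b c e → a * b * (c * e) ≡ a * c * (b * e)
  interchange = solve-∀

-- The uncovered part is an integer: if it were at least 1, cancelling `d ^ (r * suc d)` in the
-- greedy estimate would leave `2 ^ r ≤ n`. The cancellation uses that `d` is nonzero.
fullCover : ∀ (sets : Vec (Subset n) m) d .{{_ : NonZero d}} .{{_ : NonZero m}} →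
  (∀ x → m ≤ suc d * Vec.count (x ∈?_) sets) → ∀ r → n < 2 ^ r →
  ∃ λ is → length is ≡ r * suc d × n ≤ ∣ cover sets ∅ is ∣
fullCover {n} sets d dense r n< with greedy sets d dense (r * suc d) ∅
... | is , eq , le with ∣ ∁ (cover sets ∅ is) ∣ in uncovered
...   | zero  = is , eq , m∸n≡0⇒m≤n (trans (sym (∣∁p∣≡n∸∣p∣ (cover sets ∅ is))) uncovered)
...   | suc u = contradiction (*-cancelʳ-≤ _ _ (d ^ (r * suc d)) {{m^n≢0 d (r * suc d)}} (begin
  2 ^ r * d ^ (r * suc d)        ≤⟨ halved^ d r ⟩
  suc d ^ (r * suc d)            ≤⟨ m≤m*n _ (suc u) ⟩
  suc d ^ (r * suc d) * suc u    ≤⟨ le ⟩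
  d ^ (r * suc d) * ∣ ∁ (∅ {n}) ∣  ≤⟨ *-monoʳ-≤ (d ^ (r * suc d)) (∣p∣≤n (∁ (∅ {n}))) ⟩
  d ^ (r * suc d) * n            ≡⟨ *-comm _ n ⟩
  n * d ^ (r * suc d)            ∎)) (<⇒≱ n<)
  where open ≤-Reasoning

-- The search on encoded instances

-- Every ♯ opens a block, and the last one is followed by nothing: hence the empty block at the end,
-- which supplies the empty set as a choice.
familyBlocks : List (Subset n) → List Block
familyBlocks []       = (true , []) ∷ []
familyBlocks (s ∷ ss) = (true , toList s) ∷ familyBlocks ss

encodeSets : List (Subset n) → List Symbol
encodeSets = concatMap (λ s → map bit (toList s) ++ [ ♯ ])

blocks-encodeSets : ∀ (ss : List (Subset n)) → blocks (encodeSets ss) ≡ flatten (familyBlocks ss)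
blocks-encodeSets []       = refl
blocks-encodeSets (s ∷ ss) = cong (mark true ∷_) (trans (one-set (toList s))
  (cong (map elem (toList s) ++_) (blocks-encodeSets ss)))
  where
  one-set : ∀ xs → map fromSymbol ((map bit xs ++ [ ♯ ]) ++ encodeSets ss) ≡
            map elem xs ++ blocks (encodeSets ss)
  one-set []       = refl
  one-set (x ∷ xs) = cong (elem x ∷_) (one-set xs)

live-≤ : ∀ bs → live bs ≤ length (flatten bs)
live-≤ []                 = z≤n
live-≤ ((true , s) ∷ bs)  = s≤s (≤-trans (live-≤ bs)
  (≤-trans (m≤n+m _ (length (map elem s))) (≤-reflexive (sym (length-++ (map elem s))))))
live-≤ ((false , s) ∷ bs) = m≤n⇒m≤1+n (≤-trans (live-≤ bs)
  (≤-trans (m≤n+m _ (length (map elem s))) (≤-reflexive (sym (length-++ (map elem s))))))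

-- The family has a first set, whose characteristic vector alone contributes `n` symbols. This is
-- what makes `2 ^ r` exceed `n`.
n≤flatten : ∀ (sets : Vec (Subset n) m) .{{_ : NonZero m}} → n ≤ length (flatten (familyBlocks (toList sets)))
n≤flatten {n} (s ∷ sets) = begin
  n                                ≡⟨ length-toList s ⟨
  length (toList s)                ≡⟨ length-map elem (toList s) ⟨
  length (map elem (toList s))     ≤⟨ m≤m+n _ _ ⟩
  length (map elem (toList s)) + length rest ≡⟨ length-++ (map elem (toList s)) ⟨
  length (map elem (toList s) ++ rest) ≤⟨ n≤1+n _ ⟩
  suc (length (map elem (toList s) ++ rest)) ∎
  where
  open ≤-Reasoning
  rest : List Item
  rest = flatten (familyBlocks (toList sets))

-- There is one flag for every symbol of the family, hence more than `n` of them in general; `pad`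
-- is the surplus, which no block of an encoding reaches.
merge-∪ : ∀ (p q : Subset n) pad → merge (toList p ++ pad) (toList q) ≡ toList (p ∪ q) ++ pad
merge-∪ []      []      pad = merge-[] pad
merge-∪ (x ∷ p) (y ∷ q) pad = cong ((x ∨ y) ∷_) (merge-∪ p q pad)

trues-toList : ∀ (p : Subset n) k → trues (toList p ++ replicate k false) ≡ ∣ p ∣
trues-toList []          zero    = refl
trues-toList []          (suc k) = trues-toList [] k
trues-toList (true ∷ p)  k       = cong suc (trues-toList p k)
trues-toList (false ∷ p) k       = trues-toList p k

replicate-∅ : ∀ n k → replicate (n + k) false ≡ toList (∅ {n}) ++ replicate k false
replicate-∅ zero    k = refl
replicate-∅ (suc n) k = cong (false ∷_) (replicate-∅ n k)

module _ (sets : Vec (Subset n) m) where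

  Choice : List Bool → Set
  Choice s = s ∈ˡ map proj₂ (familyBlocks (toList sets))

  index : ∀ {s} → Choice s → s ≡ [] ⊎ (∃ λ i → s ≡ toList (lookup sets i))
  index = go sets
    where
    go : ∀ {m} (sets : Vec (Subset n) m) {s} → s ∈ˡ map proj₂ (familyBlocks (toList sets)) →
         s ≡ [] ⊎ (∃ λ i → s ≡ toList (lookup sets i))
    go []         (here refl) = inj₁ refl
    go (t ∷ sets) (here refl) = inj₂ (zero , refl)
    go (t ∷ sets) (there s∈)  = Sum.map₂ (λ (i , eq) → suc i , eq) (go sets s∈)

  last-block : (true , []) ∈ˡ familyBlocks (toList sets)
  last-block = go (toList sets)
    where
    go : ∀ (ss : List (Subset n)) → (true , []) ∈ˡ familyBlocks ss
    go []       = here refl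
    go (s ∷ ss) = there (go ss)

  live-block : ∀ i → (true , toList (lookup sets i)) ∈ˡ familyBlocks (toList sets)
  live-block = go sets
    where
    go : ∀ {m} (sets : Vec (Subset n) m) i → (true , toList (lookup sets i)) ∈ˡ familyBlocks (toList sets)
    go (s ∷ sets) zero    = here refl
    go (s ∷ sets) (suc i) = there (go sets i)

  choice-live : ∀ {s} → Choice s → (true , s) ∈ˡ familyBlocks (toList sets)
  choice-live c with index c
  ... | inj₁ refl       = last-block
  ... | inj₂ (i , refl) = live-block i

  -- Choices of the empty block have no index and are dropped, so the list of indices can be
  -- shorter.
  indices : ∀ pad U ss → All Choice ss → ∃ λ is → length is ≤ length ss ×
    List.foldl merge (toList U ++ pad) ss ≡ toList (cover sets U is) ++ pad
  indices pad U []       []       = [] , z≤n , refl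
  indices pad U (s ∷ ss) (c ∷ cs) with index c
  ... | inj₁ refl rewrite merge-[] (toList U ++ pad) =
    let is , le , eq = indices pad U ss cs in is , m≤n⇒m≤1+n le , eq
  ... | inj₂ (i , refl) rewrite merge-∪ U (lookup sets i) pad =
    let is , le , eq = indices pad (add sets U i) ss cs in i ∷ is , s≤s le , eq

  merge-cover : ∀ pad U is → List.foldl merge (toList U ++ pad) (map (toList ∘ lookup sets) is) ≡
    toList (cover sets U is) ++ pad
  merge-cover pad U []       = refl
  merge-cover pad U (i ∷ is) rewrite merge-∪ U (lookup sets i) pad = merge-cover pad (add sets U i) is

  choices : ∀ is → All Choice (map (toList ∘ lookup sets) is)
  choices []       = []
  choices (i ∷ is) = ∈-map⁺ proj₂ (live-block i) ∷ choices is

  chosen : Subset m → List (Subset n)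
  chosen J = map (lookup sets) (List.filter (_∈? J) (List.allFin m))

  cover⊆⋃ : ∀ is → cover sets ∅ is ⊆ ⋃ (chosen (fromElements is))
  cover⊆⋃ is {x} x∈ with cover-sound sets ∅ is x∈
  ... | inj₁ x∈∅ = contradiction x∈∅ ∉⊥
  ... | inj₂ (i , i∈ , x∈i) = ⋃-complete (lookup sets i) _
    (∈-map⁺ (lookup sets) (∈-filter⁺ (_∈? fromElements is) (∈-allFin i) (∈-fromElements i∈))) x∈i

  ⋃⊆cover : ∀ J → ⋃ (chosen J) ⊆ cover sets ∅ (elements J)
  ⋃⊆cover J {x} x∈ with ⋃-sound (chosen J) x∈
  ... | p , p∈ , x∈p with ∈-map⁻ (lookup sets) p∈
  ...   | i , i∈ , refl = cover-complete sets ∅ (elements J)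
    (∈-elements J (proj₂ (∈-filter⁻ (_∈? J) {xs = List.allFin m} i∈))) x∈p

module _ (d : ℕ) .{{_ : NonZero d}} (sets : Vec (Subset n) m) .{{_ : NonZero m}}
         (dense : ∀ x → m ≤ suc d * Vec.count (x ∈?_) sets) (K T : List Bool) where

  private
    w : List Symbol
    w = encodeSets (toList sets)

    bs : List Block
    bs = familyBlocks (toList sets)

    r size pad : ℕ
    r    = length (counter w)
    size = length (blocks w)
    pad  = size ∸ n

    size≡ : size ≡ length (flatten bs)
    size≡ = cong length (blocks-encodeSets (toList sets))

    size< : size < 2 ^ r
    size< = subst (_< 2 ^ r) (trans (value-increments size []) (+-identityʳ size)) (value-< (counter w))

    n≤size : n ≤ size
    n≤size = ≤-trans (n≤flatten sets) (≤-reflexive (sym size≡))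

    start≡ : replicate size false ≡ toList (∅ {n}) ++ replicate pad false
    start≡ = trans (cong (λ k → replicate k false) (sym (m+[n∸m]≡n n≤size))) (replicate-∅ n pad)

    Solvable : Set
    Solvable = ∃ λ J → ∣ J ∣ ≤ value K × value T ≤ ∣ ⋃ (chosen sets J) ∣

    sound : ∀ {Q} → Guess r (blocks w) Q → ∃ λ s → Choice sets s × Q s
    sound g rewrite blocks-encodeSets (toList sets) = Guess-sound r bs (∈-map⁺ proj₂ (last-block sets)) g

    complete : ∀ {Q : List Bool → Set} {s} → Choice sets s → Q s → Guess r (blocks w) Q
    complete {Q} c q = subst (λ xs → Guess r xs Q) (sym (blocks-encodeSets (toList sets)))
      (Guess-complete r bs (≤-trans (live-≤ bs) (≤-trans (≤-reflexive (sym size≡)) (<⇒≤ size<)))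
        (choice-live sets c) q)

    covered : ∀ {is} → value T ≤ ∣ cover sets ∅ is ∣ →
      value T ≤ trues (List.foldl merge (replicate size false) (map (toList ∘ lookup sets) is))
    covered {is} le rewrite start≡ | merge-cover sets (replicate pad false) ∅ is
                          | trues-toList (cover sets ∅ is) pad = le

    search : ∀ is → length is ≤ r * suc d → length is ≤ value K → value T ≤ ∣ cover sets ∅ is ∣ →
      Algorithm.Search d w K T
    search is p q le = Cover-complete T (λ {Q} → sound {Q}) (λ {Q} → complete {Q})
      (∈-map⁺ proj₂ (last-block sets)) (r * suc d) K (replicate size false)
      (≤-trans (≤-reflexive (length-map _ is)) p) (≤-trans (≤-reflexive (length-map _ is)) q)
      (choices sets is) (covered {is} le)

  -- If `K` is at most the fuel, the sets of `J` themselves can be guessed. Otherwise `J` is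
  -- discarded for a greedy cover of all elements: it spends exactly the fuel, which `K` allows, and
  -- covers at least as much as `J`.
  Search⇔ : Algorithm.Search d w K T ⇔ Solvable
  Search⇔ = mk⇔ to′ from′
    where
    to′ : Algorithm.Search d w K T → Solvable
    to′ c with Cover-sound T (λ {Q} → sound {Q}) (λ {Q} → complete {Q}) (r * suc d) K (replicate size false) c
    ... | ss , p , cs , q with indices sets (replicate pad false) ∅ ss cs
    ...   | is , le , eq =
      fromElements is , ≤-trans (∣fromElements∣ is) (≤-trans le p) ,
      ≤-trans q (≤-trans (≤-reflexive (trans (cong trues (trans (cong (λ cs → List.foldl merge cs ss) start≡) eq))
        (trues-toList (cover sets ∅ is) pad))) (p⊆q⇒∣p∣≤∣q∣ (cover⊆⋃ sets is)))

    from′ : Solvable → Algorithm.Search d w K T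
    from′ (J , p , q) with ≤-total (r * suc d) (value K)
    ... | inj₂ K≤ = search (elements J) (≤-trans len K≤) len (≤-trans q (p⊆q⇒∣p∣≤∣q∣ (⋃⊆cover sets J)))
      where
      len : length (elements J) ≤ value K
      len = ≤-trans (≤-reflexive (elements-length J)) p
    ... | inj₁ ≤K = let is , eq , full = fullCover sets d dense r (≤-trans (s≤s n≤size) size<) in
      search is (≤-reflexive eq) (≤-trans (≤-reflexive eq) ≤K)
        (≤-trans q (≤-trans (∣p∣≤n (⋃ (chosen sets J))) full))

-- From the real `α` to an integer `c`

denominator-bound : ∀ {p a e m f} .{{_ : NonZero m}} .{c : Coprime (suc a) (suc e)} →
  mkℚ (+ suc a) e c ℚ.≤ p ℚ./ m → p ℤ.≤ + f →
  m ≤ suc (suc e) * f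
denominator-bound {p} {a} {e} {m@(suc m′)} {f} {{_}} {c} r≤p p≤f = begin
  m              ≤⟨ m≤m+n m (a * m) ⟩
  suc a * m      ≤⟨ ℤ.drop‿+≤+ (ℤ.≤-trans cross (ℤ.≤-trans (ℤ.*-monoʳ-≤-nonNeg (+ suc e) p≤f)
                      (ℤ.≤-reflexive (sym (ℤ.pos-* f (suc e)))))) ⟩
  f * suc e      ≡⟨ *-comm f (suc e) ⟩
  -- The factor is raised from `suc e` so that `c = suc d` holds with a nonzero `d`, as the decay
  -- estimate requires.
  suc e * f      ≤⟨ m≤n+m (suc e * f) f ⟩
  suc (suc e) * f ∎
  where
  open ≤-Reasoning
  -- The fraction `p ℚ./ m` is stored in lowest terms; the unnormalised rationals retain the
  -- denominator `m` for cross multiplication.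
  cross : + (suc a * m) ℤ.≤ p ℤ.* + suc e
  cross = ℚᵘ.drop-*≤* (ℚᵘ.≤-respʳ-≃ (ℚ.toℚᵘ-fromℚᵘ (ℚᵘ.mkℚᵘ p m′)) (ℚ.toℚᵘ-mono-≤ r≤p))

-- Roundedness of the cut yields a rational strictly between 0 and `α`. Were `p / m` smaller than
-- it, `p / m` would lie below `α`; as the order of the rationals is decidable, `p / m` is at least
-- this rational.
denseBound : ∀ α → Positive α → ∃ λ e → ∀ ((I , _) : ∃ (Dense α)) →
  ∀ x → CoverInstance.m I ≤ suc (suc e) * CoverInstance.frequency I x
denseBound α 0<α with Equivalence.to (ℝ.lower-rounded α 0ℚ) 0<α
... | mkℚ (+ zero) e c , 0<r , _ with ℤ.+<+ () ← ℚ.drop-*<* 0<r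
... | mkℚ -[1+ a ] e c , 0<r , _ with () ← ℚ.drop-*<* 0<r
... | mkℚ (+ suc a) e c , _ , r<α = e , λ (I , p , p≤ , p/m≥α) x →
  denominator-bound {c = c}
    (ℚ.≮⇒≥ λ p/m<r → p/m≥α (Equivalence.from (ℝ.lower-rounded α _) (_ , p/m<r , r<α))) (p≤ x)

-- Encoded numbers and asymptotic bounds

isOne : Fin 2 → Bool
isOne zero    = false
isOne (suc _) = true

digitBits : ℕ → List Bool
digitBits k = map isOne (proj₁ (toDigits 2 k))

encode-+ : ∀ k → encodeℤ (+ k) ≡ bit false ∷ map bit (digitBits k)
encode-+ k = cong (bit false ∷_) (trans (map-cong digit-isOne _) (map-∘ _))
  where
  digit-isOne : ∀ x → digit x ≡ bit (isOne x)
  digit-isOne zero    = refl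
  digit-isOne (suc _) = refl

value-digits : ∀ k → value (digitBits k) ≡ k
value-digits k = trans (go (proj₁ (toDigits 2 k))) (proj₂ (toDigits 2 k))
  where
  go : ∀ ds → value (map isOne ds) ≡ fromDigits ds
  go []              = refl
  go (zero ∷ ds)     = trans (cong (2 *_) (go ds)) (*-comm 2 (fromDigits ds))
  go (suc zero ∷ ds) = cong suc (trans (cong (2 *_) (go ds)) (*-comm 2 (fromDigits ds)))

totalTime-cubic : ∀ d n → totalTime d (suc n) ≤ (18 * d + 56) * suc n ^ 3
totalTime-cubic d n = ≤-trans (m≤m+n _ slack) (≤-reflexive (eq d n))
  where
  -- As a polynomial in `N = suc n`, `totalTime` has coefficient sum `18 * d + 49`, and each power
  -- of `N` up to the third is at most the cube. In terms of `n` the difference has nonnegative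
  -- coefficients, listed here.
  slack : ℕ
  slack = 7 + 114 * n + 149 * (n * n) + 54 * (n * n * n) +
    23 * (d * n) + 39 * (d * (n * n)) + 16 * (d * (n * n * n))
  eq : ∀ d n →
    let N = suc n
        R = N + suc N + (N * (3 + (N + N)) + (5 + (N + N + (N + N))))
        F = N * (4 + (N + N)) + (2 + N)
        L = N * suc d * suc R + (suc N + F)
    in suc (N + suc (suc N + suc (N + suc (suc N +
         (N * (3 + (N + N)) + suc (suc N + (suc N + L))))))) +
       (7 + 114 * n + 149 * (n * n) + 54 * (n * n * n) +
         23 * (d * n) + 39 * (d * (n * n)) + 16 * (d * (n * n * n)))
       ≡ (18 * d + 56) * (N * (N * (N * 1)))
  eq = solve-∀

totalTime-polynomial : ∀ d → totalTime d =O (_^ 3)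
totalTime-polynomial d = 18 * d + 56 , 1 , λ { (suc n) _ → totalTime-cubic d n }

-- From `n = 2` on, the logarithm `l` is at least 1, so `suc l ≤ 2 * l`; squaring gives the 4.
bitBudget-log² : ∀ d → Algorithm.bitBudget d =O (λ n → ⌊log₂ n ⌋ ^ 2)
bitBudget-log² d = 4 * suc d , 2 , λ n 2≤n → squared ⌊log₂ n ⌋ (⌊log₂⌋-mono-≤ {2} {n} 2≤n)
  where
  squared : ∀ l → 1 ≤ l → suc l * suc d * suc l ≤ 4 * suc d * l ^ 2
  squared (suc l) _ = ≤-trans (m≤m+n _ (suc d * (4 * l + 3 * (l * l)))) (≤-reflexive (eq d l))
    where
    eq : ∀ d l → suc (suc l) * suc d * suc (suc l) + suc d * (4 * l + 3 * (l * l)) ≡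
         4 * suc d * (suc l * (suc l * 1))
    eq = solve-∀

decides : ∀ d .{{_ : NonZero d}} I → (∀ x → CoverInstance.m I ≤ suc d * CoverInstance.frequency I x) →
  Run.Accepts (Algorithm.machine d) (Run.initial (Algorithm.machine d) (encodeCover I)) ⇔ CoverInstance.Coverable I
decides d I dense = go K T
  where
  open CoverInstance I using (sets; K; T; m≢0)
  open Algorithm d
  open Run machine using (Accepts; initial)

  Covers : ℤ → ℤ → Set
  Covers K T = ∃ λ J → + ∣ J ∣ ℤ.≤ K × T ℤ.≤ + ∣ ⋃ (chosen sets J) ∣

  w : List Symbol
  w = encodeSets (toList sets)

  negativeK : ∀ {k u} v T → u ≡ bit true ∷ v →
    Accepts (initial (u ++ ♯ ∷ encodeℤ T ++ ♯ ∷ w)) ⇔ Covers -[1+ k ] T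
  negativeK v T refl = mk⇔ (λ a → contradiction (Equivalence.to (accepting stop) a) λ ())
                            (λ { (J , () , _) })
    where
    stop : Behaves 0 0 (initial (bit true ∷ v ++ ♯ ∷ encodeℤ T ++ ♯ ∷ w)) (false ≡ true)
    stop = halt! refl

  negativeT : ∀ {u v k t} v′ K → u ≡ bit false ∷ map bit K → v ≡ bit true ∷ v′ →
    Accepts (initial (u ++ ♯ ∷ v ++ ♯ ∷ w)) ⇔ Covers (+ k) -[1+ t ]
  negativeT v K refl refl =
    mk⇔ (λ _ → ∅ , +≤+ (≤-trans (≤-reflexive (∣⊥∣≡0 (CoverInstance.m I))) z≤n) , -≤+)
        (λ _ → Equivalence.from (accepting stop) refl)
    where
    stop : Behaves _ 0 (initial (bit false ∷ map bit K ++ ♯ ∷ bit true ∷ v ++ ♯ ∷ w)) (true ≡ true)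
    stop = readK {t = 0} {w = bit true ∷ v ++ ♯ ∷ w} K ≤-refl λ _ → halt! refl

  -- An encoded number has the form read by the machine only up to a proved equation, so the words
  -- are variables `u` and `v` until the equations are matched.
  nonNegative : ∀ {u v k t} K T → u ≡ bit false ∷ map bit K → v ≡ bit false ∷ map bit T →
    value K ≡ k → value T ≡ t → Accepts (initial (u ++ ♯ ∷ v ++ ♯ ∷ w)) ⇔ Covers (+ k) (+ t)
  nonNegative K T refl refl refl refl = mk⇔
    (widen ∘ Equivalence.to search ∘ Equivalence.to (accepting run))
    (Equivalence.from (accepting run) ∘ Equivalence.from search ∘ narrow)
    where
    Solvable : Set
    Solvable = ∃ λ J → ∣ J ∣ ≤ value K × value T ≤ ∣ ⋃ (chosen sets J) ∣

    widen : Solvable → Covers (+ value K) (+ value T)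
    widen (J , p , q) = J , +≤+ p , +≤+ q

    narrow : Covers (+ value K) (+ value T) → Solvable
    narrow (J , +≤+ p , +≤+ q) = J , p , q

    search : Search w K T ⇔ Solvable
    search = Search⇔ d sets dense K T

    -- The time parameter is just some common bound for the three lengths, since only the acceptance
    -- half of `run` enters here.
    run : Behaves (totalTime d (length K + (length T + suc (length w)))) (bitBound w)
      (initial (bit false ∷ map bit K ++ ♯ ∷ bit false ∷ map bit T ++ ♯ ∷ w)) (Search w K T)
    run = valid w {length K + (length T + suc (length w))} K T (m≤m+n (length K) _)
      (≤-trans (m≤m+n (length T) _) (m≤n+m _ (length K)))
      (≤-trans (m≤n+m _ (length T)) (m≤n+m _ (length K)))

  go : ∀ K T → Accepts (initial (encodeℤ K ++ ♯ ∷ encodeℤ T ++ ♯ ∷ w)) ⇔ Covers K T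
  go -[1+ k ] T        = negativeK _ T refl
  go (+ k)    -[1+ t ] = negativeT _ (digitBits k) (encode-+ k) refl
  go (+ k)    (+ t)    = nonNegative (digitBits k) (digitBits t)
    (encode-+ k) (encode-+ t) (value-digits k) (value-digits t)

mainTheorem10 : (α : ℝ) → Positive α → LessThanOne α → MaxCover α ∈ β 2
mainTheorem10 α 0<α α<1 =
  let e , dense = denseBound α 0<α
      d         = suc e
  in Algorithm.machine d
   , (totalTime d , Algorithm.bitBudget d , (3 , totalTime-polynomial d) , bitBudget-log² d , Algorithm.bounded d)
   , λ (I , δ) → decides d I (dense (I , δ))
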